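{- Let $k$ and $r$ be fixed integers with $k>r\ge 0$, and let $i=\sqrt{ -1}$. Then for every integer $n\ge 0$, $$\sum_{m=0}^n B_{km+r}B_{k(n-m)+r}=B_{k-r}\left(-(n+1)B_{k(n+1)+r}+\sum_{j=0}^n\frac{B_kB_{k-r}^j}{2}\left(\frac{(-1)^j}{(B_k+B_r)^{j+1}}+\frac{1}{(B_k-B_r)^{j+1}}\right)(n-j+1)B_{k(n-j+1)+r}\right)$$ and $$\sum_{m=0}^n C_{km+r}C_{k(n-m)+r}=C_{k-r}\left((n+1)C_{k(n+1)+r}-\sum_{j=0}^n\frac{2\sqrt2\,B_k(C_{k-r}i)^j}{2}\left(\frac{1}{(2\sqrt2B_k+C_ri)^{j+1}}+\frac{(-1)^j}{(2\sqrt2B_k-C_ri)^{j+1}}\right)(n-j+1)C_{k(n-j+1)+r}\right).$$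
   Context: The balancing numbers are defined by $B_0=0$, $B_1=1$, $B_n=6B_{n-1}-B_{n-2}$ for $n\ge 2$. The Lucas-balancing numbers are defined by $C_0=1$, $C_1=3$, $C_n=6C_{n-1}-C_{n-2}$ for $n\ge 2$. -}

module Defs where

open import Data.Nat as ℕ using (ℕ; zero; suc)
open import Data.Integer as ℤ using (ℤ)
open import Data.Rational as ℚ using (ℚ; 0ℚ; 1ℚ; _/_)
open import Data.Rational.Properties using (_≟_)
open import Relation.Nullary using (yes; no)

-- Balancing numbers: B 0 = 0, B 1 = 1, B (n+2) = 6 B (n+1) - B n  (over ℤ)
B : ℕ → ℤ
B zero = ℤ.+ 0
B (suc zero) = ℤ.+ 1
B (suc (suc n)) = ℤ.+ 6 ℤ.* B (suc n) ℤ.- B n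

-- Lucas-balancing numbers: C 0 = 1, C 1 = 3, C (n+2) = 6 C (n+1) - C n
C : ℕ → ℤ
C zero = ℤ.+ 1
C (suc zero) = ℤ.+ 3
C (suc (suc n)) = ℤ.+ 6 ℤ.* C (suc n) ℤ.- C n

⟦_⟧ : ℤ → ℚ
⟦ z ⟧ = z / 1

-- total inverse on ℚ (0 ↦ 0; only ever applied to nonzero values here)
invℚ : ℚ → ℚ
invℚ p with p ≟ 0ℚ
... | yes _ = 0ℚ
... | no p≢0 = ℚ.1/_ p {{ℚ.≢-nonZero p≢0}}

powℚ : ℚ → ℕ → ℚ
powℚ x zero = 1ℚ
powℚ x (suc n) = x ℚ.* powℚ x n

sumℚ : ℕ → (ℕ → ℚ) → ℚ
sumℚ zero f = f 0
sumℚ (suc n) f = sumℚ n f ℚ.+ f (suc n)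

record Q2 : Set where
  constructor _+_√2
  field re ir : ℚ
open Q2 public

infix 10 _+_√2

_+₂_ : Q2 → Q2 → Q2
(a + b √2) +₂ (c + d √2) = (a ℚ.+ c) + (b ℚ.+ d) √2

-₂_ : Q2 → Q2
-₂ (a + b √2) = (ℚ.- a) + (ℚ.- b) √2

_*₂_ : Q2 → Q2 → Q2
(a + b √2) *₂ (c + d √2) =
  (a ℚ.* c ℚ.+ (ℤ.+ 2 / 1) ℚ.* (b ℚ.* d)) + (a ℚ.* d ℚ.+ b ℚ.* c) √2

-- inverse: (p + q√2)⁻¹ = (p - q√2) / (p² - 2q²)   (0 ↦ 0)
inv₂ : Q2 → Q2
inv₂ (p + q √2) =
  let n = invℚ (p ℚ.* p ℚ.- (ℤ.+ 2 / 1) ℚ.* (q ℚ.* q)) in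
  (p ℚ.* n) + (ℚ.- (q ℚ.* n)) √2

record K : Set where
  constructor _+_i
  field reK imK : Q2
open K public

infix 10 _+_i

0Q2 1Q2 : Q2
0Q2 = 0ℚ + 0ℚ √2
1Q2 = 1ℚ + 0ℚ √2

0K 1K : K
0K = 0Q2 + 0Q2 i
1K = 1Q2 + 0Q2 i

𝕚 : K
𝕚 = 0Q2 + 1Q2 i

√2K : K
√2K = (0ℚ + 1ℚ √2) + 0Q2 i

_+K_ : K → K → K
(a + b i) +K (c + d i) = (a +₂ c) + (b +₂ d) i

-K_ : K → K
-K (a + b i) = (-₂ a) + (-₂ b) i

_-K_ : K → K → K
x -K y = x +K (-K y)

_*K_ : K → K → K
(a + b i) *K (c + d i) =
  ((a *₂ c) +₂ (-₂ (b *₂ d))) + ((a *₂ d) +₂ (b *₂ c)) i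

-- inverse: (u + v i)⁻¹ = (u - v i) / (u² + v²)   (0 ↦ 0)
invK : K → K
invK (u + v i) =
  let n = inv₂ ((u *₂ u) +₂ (v *₂ v)) in
  (u *₂ n) + (-₂ (v *₂ n)) i

infixl 6 _+K_ _-K_
infixl 7 _*K_

powK : K → ℕ → K
powK x zero = 1K
powK x (suc n) = x *K powK x n

ℚ→K : ℚ → K
ℚ→K q = (q + 0ℚ √2) + 0Q2 i

ℤ→K : ℤ → K
ℤ→K z = ℚ→K ⟦ z ⟧

sumK : ℕ → (ℕ → K) → K
sumK zero f = f 0
sumK (suc n) f = sumK n f +K f (suc n)

sgnℚ : ℕ → ℚ
sgnℚ j = powℚ (ℚ.- 1ℚ) j

{-# OPTIONS --safe #-}

-- Put F = Σ B_{km+r} xᵐ, D = 1 − 2 C_k x + x² and N = B_r + B_{k−r} x.  The recurrence gives D F = N,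
-- and differentiating this gives B_{k−r} D² F′ = B_k² − N².  Since D² F² = N², it follows that
--     F² = B_{k−r} F′ (B_k² / (B_k² − N²) − 1),
-- and the formula is read off from B_k² / (B_k² − N²) = (B_k / 2) (1 / (B_k + N) + 1 / (B_k − N)).
-- The Lucas-balancing case is the same with N = C_r − C_{k−r} x and B_k replaced by b = −2√2 B_k i, for which
-- b² = −8 B_k² = C_r² + C_{k−r}² − 2 C_k C_r C_{k−r}.
module Submission where

open import Defs
open import Data.Nat as ℕ using (ℕ; zero; suc; _<_; _∸_)
import Data.Nat.Properties as ℕₚ
import Data.Nat.Solver
open import Data.Integer as ℤ using (ℤ; +_; 0ℤ; 1ℤ; -1ℤ)
import Data.Integer.Properties as ℤₚ
import Data.Integer.Solver
open import Data.Rational as ℚ using (ℚ; 0ℚ; 1ℚ; _/_; toℚᵘ)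
import Data.Rational.Properties as ℚₚ
open import Data.Rational.Unnormalised.Base as ℚᵘ using (mkℚᵘ; *≡*)
import Data.Rational.Unnormalised.Properties as ℚᵘₚ
open import Data.Maybe.Base as Maybe using (Maybe)
open import Data.Product using (_×_; _,_; proj₁; proj₂; ∃₂)
open import Data.Sum using (inj₁; inj₂)
open import Function using (_∘_; _⟨_⟩_)
open import Level using (0ℓ)
open import Algebra.Bundles using (CommutativeRing)
open import Algebra.Bundles.Raw using (RawRing)
open import Algebra.Core using (Op₁; Op₂)
open import Algebra.Structures using (IsCommutativeRing)
import Algebra.Consequences.Propositional
import Algebra.Construct.Pointwise as Pointwise
import Algebra.Properties.CommutativeSemigroup
import Algebra.Properties.CommutativeSemiring.Exp
import Algebra.Properties.Ring
import Algebra.Solver.Ring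
open import Algebra.Solver.Ring.AlmostCommutativeRing
  using (_-Raw-AlmostCommutative⟶_; fromCommutativeRing)
open import Relation.Binary.Consequences using (dec⇒weaklyDec)
open import Relation.Binary.PropositionalEquality as ≡
  using (_≡_; _≢_; module ≡-Reasoning)
import Relation.Binary.Reasoning.Setoid
open import Relation.Nullary using (yes; no; contradiction)

-- Write t = 2 C_k, p + q X for N, and b for the number in the role of B_k. The constant p² + q² + t
-- p q is the norm of N modulo D, that is N(α) N(1/α) for the roots α, 1/α of D. All that is special
-- to the two families is the value of this norm: B_k² for the balancing numbers and -8 B_k² for the
-- Lucas-balancing numbers, where q = -C_{k-r}. The negative sign is what forces an imaginary b, and
-- b ± C_r = -i (2√2 B_k ± C_r i) then yields the displayed denominators.
--
-- The argument is therefore carried out once, over any commutative ring that receives ℤ, and every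
-- division becomes multiplication by an explicit inverse. D is a unit because its constant term is
-- 1; b + p and b - p are units by assumption. In the applications these units come from the strict
-- growth of B together with r < k, and from 8 B_k² + C_r² > 0. The inverses of `ℚ`, `Q2` and `K`
-- are total with value 0 at 0, so each one that occurs in the statement has to be matched with a
-- genuine inverse.

ℤ-ring : RawRing _ _
ℤ-ring = CommutativeRing.rawRing ℤₚ.+-*-commutativeRing

_-ℤ⟶ : ∀ {c ℓ} → CommutativeRing c ℓ → Set _
_-ℤ⟶ R = ℤ-ring -Raw-AlmostCommutative⟶ fromCommutativeRing R

module ℤ-Solver {c ℓ} (R : CommutativeRing c ℓ) (φ : R -ℤ⟶) where
  open _-Raw-AlmostCommutative⟶_ φ renaming (⟦_⟧ to ι)
  open CommutativeRing R

  ι-weaklyDec : ∀ x y → Maybe (ι x ≈ ι y)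
  ι-weaklyDec x y =
    Maybe.map (λ { ≡.refl → refl }) (dec⇒weaklyDec ℤ._≟_ x y)

  open Algebra.Solver.Ring ℤ-ring (fromCommutativeRing R) φ ι-weaklyDec public
    using (solve; con; _:=_; _:+_; _:*_; _:-_; :-_)

-- Formal power series over a commutative ring.

module PowerSeries {c ℓ} (R : CommutativeRing c ℓ) where
  open CommutativeRing R
  open Algebra.Properties.CommutativeSemigroup +-commutativeSemigroup
    using () renaming (interchange to +-interchange; x∙yz≈y∙xz to x+yz≈y+xz)
  open Relation.Binary.Reasoning.Setoid setoid

  Series : Set c
  Series = ℕ → Carrier

  infix  4 _≋_
  infixl 6 _⊕_
  infixl 7 _⊛_
  infixr 8 _·_

  _≋_ : Series → Series → Set ℓ
  f ≋ g = ∀ n → f n ≈ g n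

  _⊕_ : Series → Series → Series
  (f ⊕ g) n = f n + g n

  _·_ : Carrier → Series → Series
  (x · f) n = x * f n

  shift : Series → Series
  shift f n = f (suc n)

  -- The Cauchy product, by recursion on the constant term of the left factor. This keeps truncated
  -- subtraction out of the ring laws; `∑-⊛` recovers the usual sum.
  _⊛_ : Series → Series → Series
  (f ⊛ g) zero    = f 0 * g 0
  (f ⊛ g) (suc n) = f 0 * g (suc n) + (shift f ⊛ g) n

  κ : Carrier → Series
  κ x zero    = x
  κ x (suc _) = 0#

  X : Series
  X zero    = 0#
  X (suc n) = κ 1# n

  ⊛-cong : ∀ {f f′ g g′} → f ≋ f′ → g ≋ g′ → f ⊛ g ≋ f′ ⊛ g′
  ⊛-cong f≋ g≋ zero    = *-cong (f≋ 0) (g≋ 0)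
  ⊛-cong f≋ g≋ (suc n) =
    +-cong (*-cong (f≋ 0) (g≋ (suc n))) (⊛-cong (f≋ ∘ suc) g≋ n)

  ⊛-distribˡ : ∀ f g h → f ⊛ (g ⊕ h) ≋ (f ⊛ g) ⊕ (f ⊛ h)
  ⊛-distribˡ f g h zero    = distribˡ _ _ _
  ⊛-distribˡ f g h (suc n) =
    trans (+-cong (distribˡ _ _ _) (⊛-distribˡ (shift f) g h n)) (+-interchange _ _ _ _)

  ⊛-distribʳ : ∀ h f g → (f ⊕ g) ⊛ h ≋ (f ⊛ h) ⊕ (g ⊛ h)
  ⊛-distribʳ h f g zero    = distribʳ _ _ _
  ⊛-distribʳ h f g (suc n) =
    trans (+-cong (distribʳ _ _ _) (⊛-distribʳ h (shift f) (shift g) n)) (+-interchange _ _ _ _)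

  ·-⊛-assoc : ∀ x f g → (x · f) ⊛ g ≋ x · (f ⊛ g)
  ·-⊛-assoc x f g zero    = *-assoc _ _ _
  ·-⊛-assoc x f g (suc n) =
    trans (+-cong (*-assoc _ _ _) (·-⊛-assoc x (shift f) g n)) (sym (distribˡ _ _ _))

  -- The mirror image of the defining recursion; commutativity is the comparison of the two.
  ⊛-sucʳ : ∀ f g n → (f ⊛ g) (suc n) ≈ f (suc n) * g 0 + (f ⊛ shift g) n
  ⊛-sucʳ f g zero    = +-comm _ _
  ⊛-sucʳ f g (suc n) =
    trans (+-congˡ (⊛-sucʳ (shift f) g n)) (x+yz≈y+xz _ _ _)

  ⊛-comm : ∀ f g → f ⊛ g ≋ g ⊛ f
  ⊛-comm f g zero    = *-comm _ _
  ⊛-comm f g (suc n) =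
    trans (+-cong (*-comm _ _) (⊛-comm (shift f) g n)) (sym (⊛-sucʳ g f n))

  ⊛-assoc : ∀ f g h → (f ⊛ g) ⊛ h ≋ f ⊛ (g ⊛ h)
  ⊛-assoc f g h zero    = *-assoc _ _ _
  ⊛-assoc f g h (suc n) = begin
    f 0 * g 0 * h (suc n) + ((f 0 · shift g ⊕ shift f ⊛ g) ⊛ h) n
      ≈⟨ +-cong (*-assoc _ _ _) (⊛-distribʳ h (f 0 · shift g) (shift f ⊛ g) n) ⟩
    f 0 * (g 0 * h (suc n)) + (((f 0 · shift g) ⊛ h) n + ((shift f ⊛ g) ⊛ h) n)
      ≈⟨ +-congˡ (+-cong (·-⊛-assoc (f 0) (shift g) h n) (⊛-assoc (shift f) g h n)) ⟩
    f 0 * (g 0 * h (suc n)) + (f 0 * (shift g ⊛ h) n + (shift f ⊛ (g ⊛ h)) n)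
      ≈⟨ +-assoc _ _ _ ⟨
    f 0 * (g 0 * h (suc n)) + f 0 * (shift g ⊛ h) n + (shift f ⊛ (g ⊛ h)) n
      ≈⟨ +-congʳ (distribˡ _ _ _) ⟨
    f 0 * (g 0 * h (suc n) + (shift g ⊛ h) n) + (shift f ⊛ (g ⊛ h)) n ∎

  0⊛ : ∀ g n → ((λ _ → 0#) ⊛ g) n ≈ 0#
  0⊛ g zero    = zeroˡ _
  0⊛ g (suc n) = trans (+-cong (zeroˡ _) (0⊛ g n)) (+-identityˡ 0#)

  κ⊛ : ∀ x g → κ x ⊛ g ≋ x · g
  κ⊛ x g zero    = refl
  κ⊛ x g (suc n) = trans (+-congˡ (0⊛ g n)) (+-identityʳ _)

  κ1⊛ : ∀ g → κ 1# ⊛ g ≋ g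
  κ1⊛ g n = trans (κ⊛ 1# g n) (*-identityˡ _)

  X⊛-zero : ∀ g → (X ⊛ g) 0 ≈ 0#
  X⊛-zero g = zeroˡ _

  X⊛-suc : ∀ g n → (X ⊛ g) (suc n) ≈ g n
  X⊛-suc g n = trans (+-cong (zeroˡ _) (κ1⊛ g n)) (+-identityˡ _)

  seriesRing : CommutativeRing c ℓ
  seriesRing = record
    { Carrier = Series
    ; _≈_ = _≋_
    ; _+_ = _⊕_
    ; _*_ = _⊛_
    ; -_ = λ f n → - f n
    ; 0# = λ _ → 0#
    ; 1# = κ 1#
    ; isCommutativeRing = record
      { isRing = record
        { +-isAbelianGroup = Pointwise.isAbelianGroup ℕ +-isAbelianGroup
        ; *-cong = ⊛-cong
        ; *-assoc = ⊛-assoc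
        ; *-identity = κ1⊛ , λ f n → trans (⊛-comm f (κ 1#) n) (κ1⊛ f n)
        ; distrib = ⊛-distribˡ , ⊛-distribʳ
        }
      ; *-comm = ⊛-comm
      }
    }

  κ-cong : ∀ {x y} → x ≈ y → κ x ≋ κ y
  κ-cong x≈y zero    = x≈y
  κ-cong x≈y (suc _) = refl

  κ-+ : ∀ x y → κ (x + y) ≋ κ x ⊕ κ y
  κ-+ x y zero    = refl
  κ-+ x y (suc n) = sym (+-identityˡ 0#)

  κ-* : ∀ x y → κ (x * y) ≋ κ x ⊛ κ y
  κ-* x y zero    = refl
  κ-* x y (suc n) = sym (trans (κ⊛ x (κ y) (suc n)) (zeroʳ x))

  κ-neg : ∀ x n → κ (- x) n ≈ - κ x n
  κ-neg x zero    = refl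
  κ-neg x (suc n) = sym (Algebra.Properties.Ring.-0#≈0# ring)

  κ-0 : ∀ n → κ 0# n ≈ 0#
  κ-0 zero    = refl
  κ-0 (suc _) = refl

  series-ℤ⟶ : R -ℤ⟶ → seriesRing -ℤ⟶
  series-ℤ⟶ φ = record
    { ⟦_⟧    = κ ∘ ι
    ; +-homo = λ x y n → trans (κ-cong (+-homo x y) n) (κ-+ _ _ n)
    ; *-homo = λ x y n → trans (κ-cong (*-homo x y) n) (κ-* _ _ n)
    ; -‿homo = λ x n → trans (κ-cong (-‿homo x) n) (κ-neg _ n)
    ; 0-homo = λ n → trans (κ-cong 0-homo n) (κ-0 n)
    ; 1-homo = κ-cong 1-homo
    }
    where open _-Raw-AlmostCommutative⟶_ φ renaming (⟦_⟧ to ι)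

  ∑ : ℕ → Series → Carrier
  ∑ zero    f = f 0
  ∑ (suc n) f = ∑ n f + f (suc n)

  ∑-front : ∀ n f → ∑ (suc n) f ≈ f 0 + ∑ n (shift f)
  ∑-front zero    f = refl
  ∑-front (suc n) f = trans (+-congʳ (∑-front n f)) (+-assoc _ _ _)

  ∑-⊛ : ∀ n f g → ∑ n (λ m → f m * g (n ∸ m)) ≈ (f ⊛ g) n
  ∑-⊛ zero    f g = refl
  ∑-⊛ (suc n) f g =
    trans (∑-front n (λ m → f m * g (suc n ∸ m))) (+-congˡ (∑-⊛ n (shift f) g))

  -- The bound on `m` is kept because `suc n ∸ m` equals `suc (n ∸ m)` only for `m ≤ n`.
  ∑-cong : ∀ n {f g} → (∀ m → m ℕ.≤ n → f m ≈ g m) → ∑ n f ≈ ∑ n g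
  ∑-cong zero    e = e 0 ℕ.z≤n
  ∑-cong (suc n) e =
    +-cong (∑-cong n (λ m m≤n → e m (ℕₚ.m≤n⇒m≤1+n m≤n))) (e (suc n) ℕₚ.≤-refl)

-- Generating functions of second-order recurrences.

module Convolution {c ℓ} (R : CommutativeRing c ℓ) (φ : R -ℤ⟶) where
  open CommutativeRing R
  open _-Raw-AlmostCommutative⟶_ φ using (0-homo; 1-homo; +-homo; *-homo; -‿homo) renaming (⟦_⟧ to ι)
  open PowerSeries R public
  open Algebra.Properties.CommutativeSemiring.Exp commutativeSemiring using (_^_)
  private
    module S = CommutativeRing seriesRing
    module R-Solver = ℤ-Solver R φ
    module S-Solver = ℤ-Solver seriesRing (series-ℤ⟶ φ)
  open Relation.Binary.Reasoning.Setoid setoid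

  -- At index `n ∸ j` this is the factor (n-j+1) times the term of index n-j+1 in the displayed
  -- sums.
  deriv : Series → Series
  deriv f n = ι (ℤ.+ suc n) * f (suc n)

  ι-cong : ∀ {x y} → x ≡ y → ι x ≈ ι y
  ι-cong ≡.refl = refl

  ι1* : ∀ x → ι 1ℤ * x ≈ x
  ι1* x = trans (*-congʳ 1-homo) (*-identityˡ x)

  x-y0+0≈x : ∀ x y → x - y * 0# + 0# ≈ x
  x-y0+0≈x x y = begin
    x - y * 0# + 0#   ≈⟨ +-cong (+-congˡ (-‿cong (*-congˡ 0-homo))) 0-homo ⟨
    x - y * ι 0ℤ + ι 0ℤ
      ≈⟨ solve 2 (λ x y → x :- y :* con 0ℤ :+ con 0ℤ := x) refl x y ⟩
    x                 ∎
    where open R-Solver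

  X⊛deriv : ∀ f n → (X ⊛ deriv f) n ≈ ι (ℤ.+ n) * f n
  X⊛deriv f zero    = trans (X⊛-zero (deriv f)) (sym (trans (*-congʳ 0-homo) (zeroˡ (f 0))))
  X⊛deriv f (suc n) = X⊛-suc (deriv f) n

  module Recurrence (t : Carrier) where

    -- The constant term is written `ι 1ℤ` because that is how the series solver interprets
    -- `con 1ℤ`.
    den : Series
    den = κ (ι 1ℤ) S.- κ t ⊛ X ⊕ X ⊛ X

    den⊛ : ∀ f → den ⊛ f ≋ (f S.- t · (X ⊛ f)) ⊕ X ⊛ (X ⊛ f)
    den⊛ f n = trans
      (solve 3 (λ T x f → (con 1ℤ :- T :* x :+ x :* x) :* f :=
                          con 1ℤ :* f :- T :* (x :* f) :+ x :* (x :* f)) S.refl (κ t) X f n)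
      (+-congʳ (+-cong (trans (κ⊛ _ f n) (ι1* (f n))) (-‿cong (κ⊛ t (X ⊛ f) n))))
      where open S-Solver

    den⊛-zero : ∀ f → (den ⊛ f) 0 ≈ f 0
    den⊛-zero f = begin
      (den ⊛ f) 0 ≈⟨ den⊛ f 0 ⟩
      f 0 - t * (X ⊛ f) 0 + (X ⊛ (X ⊛ f)) 0
        ≈⟨ +-cong (+-congˡ (-‿cong (*-congˡ (X⊛-zero f)))) (X⊛-zero (X ⊛ f)) ⟩
      f 0 - t * 0# + 0# ≈⟨ x-y0+0≈x _ _ ⟩
      f 0 ∎

    den⊛-suc : ∀ f n → (den ⊛ f) (suc n) ≈ f (suc n) - t * f n + (X ⊛ f) n
    den⊛-suc f n = trans (den⊛ f (suc n))
      (+-cong (+-congˡ (-‿cong (*-congˡ (X⊛-suc f n)))) (X⊛-suc (X ⊛ f) n))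

    module Solution {p q : Carrier} {f : Series}
      (f0 : f 0 ≈ p) (f1 : f 1 ≈ t * p + q)
      (f-rec : ∀ n → f (suc (suc n)) ≈ t * f (suc n) - f n) where

      num : Series
      num = κ p ⊕ κ q ⊛ X

      f1-tf0≈q : f 1 - t * f 0 ≈ q
      f1-tf0≈q = begin
        f 1 - t * f 0      ≈⟨ +-cong f1 (-‿cong (*-congˡ f0)) ⟩
        t * p + q - t * p  ≈⟨ solve 3 (λ t p q → t :* p :+ q :- t :* p := q) refl t p q ⟩
        q                  ∎
        where open R-Solver

      f-rec≈0 : ∀ n → f (suc (suc n)) - t * f (suc n) + f n ≈ 0#
      f-rec≈0 n = begin
        f (suc (suc n)) - t * f (suc n) + f n        ≈⟨ +-congʳ (+-congʳ (f-rec n)) ⟩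
        t * f (suc n) - f n - t * f (suc n) + f n
          ≈⟨ solve 3 (λ t x y → t :* x :- y :- t :* x :+ y := con 0ℤ) refl t (f (suc n)) (f n) ⟩
        ι 0ℤ                                         ≈⟨ 0-homo ⟩
        0#                                           ∎
        where open R-Solver

      den⊛f≋num : den ⊛ f ≋ num
      den⊛f≋num n = trans (coeff n) (+-congˡ (sym (κ⊛ q X n)))
        where
        coeff : ∀ n → (den ⊛ f) n ≈ κ p n + q * X n
        coeff 0 = begin
          (den ⊛ f) 0  ≈⟨ den⊛-zero f ⟩
          f 0          ≈⟨ f0 ⟩
          p            ≈⟨ +-identityʳ p ⟨
          p + 0#       ≈⟨ +-congˡ (zeroʳ q) ⟨
          p + q * 0#   ∎
        coeff 1 = begin
          (den ⊛ f) 1                  ≈⟨ den⊛-suc f 0 ⟩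
          f 1 - t * f 0 + (X ⊛ f) 0    ≈⟨ +-cong f1-tf0≈q (X⊛-zero f) ⟩
          q + 0#                       ≈⟨ +-comm q 0# ⟩
          0# + q                       ≈⟨ +-congˡ (*-identityʳ q) ⟨
          0# + q * 1#                  ∎
        coeff (suc (suc n)) = begin
          (den ⊛ f) (suc (suc n))                  ≈⟨ den⊛-suc f (suc n) ⟩
          f (suc (suc n)) - t * f (suc n) + (X ⊛ f) (suc n)
            ≈⟨ +-congˡ (X⊛-suc f n) ⟩
          f (suc (suc n)) - t * f (suc n) + f n    ≈⟨ f-rec≈0 n ⟩
          0#                                       ≈⟨ +-identityˡ 0# ⟨
          0# + 0#                                  ≈⟨ +-congˡ (zeroʳ q) ⟨
          0# + q * 0#                              ∎

      -- The Leibniz rule applied to den ⊛ f ≋ num.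
      den⊛deriv : den ⊛ deriv f ⊕ (X ⊕ X S.- κ t) ⊛ f ≋ κ q
      den⊛deriv n = trans (+-congˡ (den′ n)) (coeff n)
        where
        den′ : (X ⊕ X S.- κ t) ⊛ f ≋ (X ⊛ f ⊕ X ⊛ f) S.- t · f
        den′ n = trans
          (solve 3 (λ T x f → (x :+ x :- T) :* f := x :* f :+ x :* f :- T :* f) S.refl (κ t) X f n)
          (+-congˡ (-‿cong (κ⊛ t f n)))
          where open S-Solver
        coeff : ∀ n → (den ⊛ deriv f) n + ((X ⊛ f) n + (X ⊛ f) n - t * f n) ≈ κ q n
        coeff zero = begin
          (den ⊛ deriv f) 0 + ((X ⊛ f) 0 + (X ⊛ f) 0 - t * f 0)
            ≈⟨ +-cong (trans (den⊛-zero (deriv f)) (ι1* (f 1)))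
                      (+-congʳ (trans (+-cong (X⊛-zero f) (X⊛-zero f)) (+-identityˡ 0#))) ⟩
          f 1 + (0# - t * f 0)   ≈⟨ +-congˡ (+-identityˡ _) ⟩
          f 1 - t * f 0          ≈⟨ f1-tf0≈q ⟩
          q                      ∎
        coeff (suc n) = begin
          (den ⊛ deriv f) (suc n) + ((X ⊛ f) (suc n) + (X ⊛ f) (suc n) - t * f (suc n))
            ≈⟨ +-cong (trans (den⊛-suc (deriv f) n) (+-congˡ (X⊛deriv f n)))
                      (+-congʳ (+-cong (X⊛-suc f n) (X⊛-suc f n))) ⟩
          ι (ℤ.+ suc (suc n)) * f (suc (suc n)) - t * (ι (ℤ.+ suc n) * f (suc n)) + ι (ℤ.+ n) * f n
            + (f n + f n - t * f (suc n))
            ≈⟨ +-congʳ (+-congʳ (+-cong (*-congʳ (+-homo (ℤ.+ 2) (ℤ.+ n)))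
                 (-‿cong (*-congˡ (*-congʳ (+-homo (ℤ.+ 1) (ℤ.+ n))))))) ⟩
          (ι (ℤ.+ 2) + ι (ℤ.+ n)) * f (suc (suc n)) - t * ((ι 1ℤ + ι (ℤ.+ n)) * f (suc n)) + ι (ℤ.+ n) * f n
            + (f n + f n - t * f (suc n))
            -- With `c` standing for the image of n, everything collects into n + 2 times the
            -- coefficient of Xⁿ⁺² in `den ⊛ f`, which the recurrence makes zero.
            ≈⟨ solve 5 (λ c t x y z →
                 (con (ℤ.+ 2) :+ c) :* z :- t :* ((con 1ℤ :+ c) :* y) :+ c :* x :+ (x :+ x :- t :* y) :=
                 (con (ℤ.+ 2) :+ c) :* (z :- t :* y :+ x))
                 refl (ι (ℤ.+ n)) t (f n) (f (suc n)) (f (suc (suc n))) ⟩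
          (ι (ℤ.+ 2) + ι (ℤ.+ n)) * (f (suc (suc n)) - t * f (suc n) + f n)
            ≈⟨ *-congˡ (f-rec≈0 n) ⟩
          (ι (ℤ.+ 2) + ι (ℤ.+ n)) * 0#  ≈⟨ zeroʳ _ ⟩
          0#                            ∎
          where open R-Solver

    -- The Chebyshev polynomials of the second kind at t/2. They satisfy the same recurrence with p
    -- = 1 and q = 0, so their numerator is 1 and they invert `den`.
    recip : Series
    recip zero          = 1#
    recip (suc zero)    = t
    recip (suc (suc n)) = t * recip (suc n) - recip n

    den⊛recip : den ⊛ recip ≋ κ 1#
    den⊛recip n = trans
      (Solution.den⊛f≋num {q = 0#} {f = recip} refl
        (sym (trans (+-identityʳ _) (*-identityʳ t))) (λ _ → refl) n)
      (trans (+-congˡ (trans (κ⊛ 0# X n) (zeroˡ _))) (+-identityʳ _))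

    -- `recip` makes `den` a unit, so cancellation is available over every commutative ring.
    den-cancel : ∀ f g → den ⊛ f ≋ den ⊛ g → f ≋ g
    den-cancel f g df≋dg = S.trans (S.sym (recover f)) (S.trans (S.*-congˡ df≋dg) (recover g))
      where
      recover : ∀ f → recip ⊛ (den ⊛ f) ≋ f
      recover f = S.trans (S.sym (S.*-assoc recip den f))
        (S.trans (S.*-congʳ (S.trans (S.*-comm recip den) den⊛recip)) (S.*-identityˡ f))

  -- The expansion of 1 / (c - x X), where `u` is the inverse of c.
  geometric : Carrier → Carrier → Series
  geometric x u n = x ^ n * u ^ suc n

  geometric-suc : ∀ c x u n → c * geometric x u (suc n) ≈ c * u * (x * geometric x u n)
  geometric-suc c x u n = solve 5
    (λ c x u y v → c :* (x :* y :* (u :* (u :* v))) := c :* u :* (x :* (y :* (u :* v))))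
    refl c x u (x ^ n) (u ^ n)
    where open R-Solver

  geometric-inverse : ∀ {c u} x → c * u ≈ 1# → (κ c S.- κ x ⊛ X) ⊛ geometric x u ≋ κ 1#
  geometric-inverse {c} {u} x cu≈1 n = trans
    (solve 4 (λ c x X g → (c :- x :* X) :* g := c :* g :- x :* (X :* g)) S.refl (κ c) (κ x) X g n)
    (trans (+-cong (κ⊛ c g n) (-‿cong (κ⊛ x (X ⊛ g) n))) (coeff n))
    where
    open S-Solver
    open Algebra.Properties.Ring ring using (-0#≈0#)
    g = geometric x u
    coeff : ∀ n → c * g n - x * (X ⊛ g) n ≈ κ 1# n
    coeff zero = begin
      c * (1# * (u * 1#)) - x * (X ⊛ g) 0
        ≈⟨ +-cong (*-congˡ (trans (*-identityˡ _) (*-identityʳ u)))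
                  (-‿cong (trans (*-congˡ (X⊛-zero g)) (zeroʳ x))) ⟩
      c * u - 0#  ≈⟨ +-cong cu≈1 -0#≈0# ⟩
      1# + 0#     ≈⟨ +-identityʳ 1# ⟩
      1#          ∎
    coeff (suc n) = begin
      c * g (suc n) - x * (X ⊛ g) (suc n)
        ≈⟨ +-cong (geometric-suc c x u n) (-‿cong (*-congˡ (X⊛-suc g n))) ⟩
      c * u * (x * g n) - x * g n
        ≈⟨ +-congʳ (trans (*-congʳ cu≈1) (*-identityˡ (x * g n))) ⟩
      x * g n - x * g n  ≈⟨ -‿inverseʳ (x * g n) ⟩
      0#                 ∎

  -- The expansion of b² / (b² − (p + q X)²) by partial fractions.
  module PartialFractions {p q b h u v : Carrier} (2h≈1 : h + h ≈ 1#)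
    ([b+p]u≈1 : (b + p) * u ≈ 1#) ([b-p]v≈1 : (b - p) * v ≈ 1#) where

    expansion : Series
    expansion = (b * h) · (geometric (- q) u ⊕ geometric q v)

    private
      N = κ p ⊕ κ q ⊛ X
      G⁺ = geometric (- q) u
      G⁻ = geometric q v

    -- Here b + N = (b + p) - (-q) X, so the ratio carries -q: the origin of the alternating sign in
    -- the formula.
    [b+N]G⁺≋1 : (κ b ⊕ N) ⊛ G⁺ ≋ κ 1#
    [b+N]G⁺≋1 = S.trans (S.*-congʳ eq) (geometric-inverse (- q) [b+p]u≈1)
      where
      open S-Solver
      eq : κ b ⊕ N ≋ κ (b + p) S.- κ (- q) ⊛ X
      eq = S.trans
        (solve 4 (λ b p q x → b :+ (p :+ q :* x) := (b :+ p) :- (:- q) :* x) S.refl (κ b) (κ p) (κ q) X)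
        (S.sym (S.+-cong (κ-+ b p) (S.-‿cong (S.*-congʳ {X} (κ-neg q)))))

    [b-N]G⁻≋1 : (κ b S.- N) ⊛ G⁻ ≋ κ 1#
    [b-N]G⁻≋1 = S.trans (S.*-congʳ eq) (geometric-inverse q [b-p]v≈1)
      where
      open S-Solver
      eq : κ b S.- N ≋ κ (b - p) S.- κ q ⊛ X
      eq = S.trans
        (solve 4 (λ b p q x → b :- (p :+ q :* x) := (b :- p) :- q :* x) S.refl (κ b) (κ p) (κ q) X)
        (S.sym (S.+-congʳ (S.trans (κ-+ b (- p)) (S.+-congˡ (κ-neg p)))))

    -- Each geometric series cancels one factor of (b - N)(b + N). The two surviving factors add up
    -- to 2b, and `h` removes the 2.
    expansion-inverse : (κ b ⊛ κ b S.- N ⊛ N) ⊛ expansion ≋ κ b ⊛ κ b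
    expansion-inverse = S.trans (S.*-congˡ lhs) (S.trans
        (solve 5 (λ b h n g₁ g₂ → (b :* b :- n :* n) :* (b :* h :* (g₁ :+ g₂)) :=
             b :* h :* ((b :- n) :* ((b :+ n) :* g₁) :+ (b :+ n) :* ((b :- n) :* g₂)))
             S.refl (κ b) (κ h) N G⁺ G⁻)
        (S.trans (S.*-congˡ (S.+-cong
            (S.trans (S.*-congˡ [b+N]G⁺≋1) (S.*-identityʳ (κ b S.- N)))
            (S.trans (S.*-congˡ [b-N]G⁻≋1) (S.*-identityʳ (κ b ⊕ N)))))
        (S.trans (solve 3 (λ b h n → b :* h :* ((b :- n) :+ (b :+ n)) := b :* b :* (h :+ h)) S.refl (κ b) (κ h) N)
        (S.trans (S.*-congˡ (S.trans (S.sym (κ-+ h h)) (κ-cong 2h≈1)))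
          (S.*-identityʳ (κ b ⊛ κ b))))))
      where
      open S-Solver
      lhs : expansion ≋ κ b ⊛ κ h ⊛ (G⁺ ⊕ G⁻)
      lhs = S.trans (S.sym (κ⊛ (b * h) (G⁺ ⊕ G⁻))) (S.*-congʳ (κ-* b h))

  -- The self-convolution of a recurrent sequence.

  module SelfConvolution {t p q b h u v : Carrier} {f : Series}
    (f0 : f 0 ≈ p) (f1 : f 1 ≈ t * p + q)
    (f-rec : ∀ n → f (suc (suc n)) ≈ t * f (suc n) - f n)
    (b² : b * b ≈ p * p + q * q + t * p * q) (2h≈1 : h + h ≈ 1#)
    ([b+p]u≈1 : (b + p) * u ≈ 1#) ([b-p]v≈1 : (b - p) * v ≈ 1#) where

    open Recurrence t
    open Solution f0 f1 f-rec
    open PartialFractions {p} {q} 2h≈1 [b+p]u≈1 [b-p]v≈1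

    κb² : κ b ⊛ κ b ≋ κ p ⊛ κ p ⊕ κ q ⊛ κ q ⊕ κ t ⊛ κ p ⊛ κ q
    κb² = S.trans (S.sym (κ-* b b)) (S.trans (κ-cong b²) (S.trans (κ-+ _ _) (S.+-cong
      (S.trans (κ-+ _ _) (S.+-cong (κ-* p p) (κ-* q q)))
      (S.trans (κ-* _ q) (S.*-congʳ (κ-* t p))))))

    -- By the derivative relation the left side is q² D - q D′ N. As a polynomial in N, q² D is P(N)
    -- = N² - (2p + t q) N + b², and q D′ = P′(N). For such a monic quadratic, P(N) - N P′(N) = P(0)
    -- - N².
    den²-deriv : den ⊛ (den ⊛ (κ q ⊛ deriv f)) ≋ κ b ⊛ κ b S.- num ⊛ num
    den²-deriv = S.trans
      (solve 6 (λ t q x f f′ d → d :* (d :* (q :* f′)) :=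
          q :* (d :* (d :* f′ :+ (x :+ x :- t) :* f) :- (x :+ x :- t) :* (d :* f)))
        S.refl (κ t) (κ q) X f (deriv f) den)
      (S.trans (S.*-congˡ {κ q} (S.+-cong (S.*-congˡ {den} den⊛deriv)
                  (S.-‿cong (S.*-congˡ {X ⊕ X S.- κ t} den⊛f≋num))))
      (S.trans
        (solve 4 (λ t p q x →
            q :* ((con 1ℤ :- t :* x :+ x :* x) :* q :- (x :+ x :- t) :* (p :+ q :* x)) :=
            p :* p :+ q :* q :+ t :* p :* q :- (p :+ q :* x) :* (p :+ q :* x))
          S.refl (κ t) (κ p) (κ q) X)
        (S.+-congʳ (S.sym κb²))))
      where open S-Solver

    -- After multiplication by D² both sides are N²: on the right `expansion` turns b² - N² into b²,
    -- from which b² - N² is subtracted.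
    f⊛f : f ⊛ f ≋ κ q ⊛ (expansion ⊛ deriv f S.- deriv f)
    f⊛f = den-cancel _ _ (den-cancel _ _ (S.trans lhs (S.sym rhs)))
      where
      open S-Solver
      lhs : den ⊛ (den ⊛ (f ⊛ f)) ≋ num ⊛ num
      lhs = S.trans (solve 2 (λ d f → d :* (d :* (f :* f)) := (d :* f) :* (d :* f)) S.refl den f)
        (S.*-cong den⊛f≋num den⊛f≋num)
      rhs : den ⊛ (den ⊛ (κ q ⊛ (expansion ⊛ deriv f S.- deriv f))) ≋ num ⊛ num
      rhs = S.trans
        (solve 4 (λ d q g f′ → d :* (d :* (q :* (g :* f′ :- f′))) :=
            (d :* (d :* (q :* f′))) :* g :- d :* (d :* (q :* f′)))
          S.refl den (κ q) expansion (deriv f))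
        (S.trans (S.+-cong (S.trans (S.*-congʳ den²-deriv) expansion-inverse) (S.-‿cong den²-deriv))
          (solve 2 (λ y n → y :- (y :- n) := n) S.refl (κ b ⊛ κ b) (num ⊛ num)))

    ∑-self-convolution : ∀ n → ∑ n (λ m → f m * f (n ∸ m)) ≈
      q * (- deriv f n + ∑ n (λ j → expansion j * deriv f (n ∸ j)))
    ∑-self-convolution n = begin
      ∑ n (λ m → f m * f (n ∸ m))                              ≈⟨ ∑-⊛ n f f ⟩
      (f ⊛ f) n                                                ≈⟨ f⊛f n ⟩
      (κ q ⊛ (expansion ⊛ deriv f S.- deriv f)) n              ≈⟨ κ⊛ q _ n ⟩
      q * ((expansion ⊛ deriv f) n - deriv f n)                ≈⟨ *-congˡ (+-comm _ _) ⟩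
      q * (- deriv f n + (expansion ⊛ deriv f) n)              ≈⟨ *-congˡ (+-congˡ (∑-⊛ n expansion (deriv f))) ⟨
      q * (- deriv f n + ∑ n (λ j → expansion j * deriv f (n ∸ j))) ∎

  module IntegralSelfConvolution {a : ℕ → ℤ} {t p q : ℤ} {b h u v : Carrier}
    (a0 : a 0 ≡ p) (a1 : a 1 ≡ t ℤ.* p ℤ.+ q)
    (a-rec : ∀ n → a (suc (suc n)) ≡ t ℤ.* a (suc n) ℤ.- a n)
    (b² : b * b ≈ ι (p ℤ.* p ℤ.+ q ℤ.* q ℤ.+ t ℤ.* p ℤ.* q)) (2h≈1 : h + h ≈ 1#)
    ([b+p]u≈1 : (b + ι p) * u ≈ 1#) ([b-p]v≈1 : (b - ι p) * v ≈ 1#) where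

    ∑-integral : ∀ n → ∑ n (λ m → ι (a m ℤ.* a (n ∸ m))) ≈
      ι q * (- (ι (ℤ.+ suc n) * ι (a (suc n))) +
             ∑ n (λ j → b * h * ((- ι q) ^ j * u ^ suc j + ι q ^ j * v ^ suc j)
                        * (ι (ℤ.+ suc (n ∸ j)) * ι (a (suc (n ∸ j))))))
    ∑-integral n = trans (∑-cong n (λ m _ → *-homo (a m) (a (n ∸ m)))) (∑-self-convolution n)
      where
      open SelfConvolution {t = ι t} {q = ι q} {f = ι ∘ a}
        (ι-cong a0)
        (trans (ι-cong a1) (trans (+-homo (t ℤ.* p) q) (+-congʳ (*-homo t p))))
        (λ m → trans (ι-cong (a-rec m)) (trans (+-homo _ _) (+-cong (*-homo t (a (suc m))) (-‿homo (a m)))))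
        (trans b² (trans (+-homo _ _) (+-cong
          (trans (+-homo _ _) (+-cong (*-homo p p) (*-homo q q)))
          (trans (*-homo _ q) (*-congʳ (*-homo t p))))))
        2h≈1 [b+p]u≈1 [b-p]v≈1

open ≡ using (refl; cong; cong₂; sym; trans; subst)

-- Balancing and Lucas-balancing numbers as coordinates of powers of λ = 3 + √8.

module Balancing where
  open Data.Integer.Solver.+-*-Solver
  open import Data.Integer.Base using (_+_; _*_; -_; _-_)
  open ≡-Reasoning

  -- Multiplication by λ on λⁿ = C_n + B_n √8. The two halves are proved together since the step for
  -- either one uses both.
  BC-suc : ∀ n → B (suc n) ≡ + 3 * B n + C n × C (suc n) ≡ + 8 * B n + + 3 * C n
  BC-suc zero    = refl , refl
  BC-suc (suc n) with BC-suc n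
  ... | B≡ , C≡ rewrite B≡ | C≡ =
    solve 2 (λ b c → con (+ 6) :* (con (+ 3) :* b :+ c) :- b :=
      con (+ 3) :* (con (+ 3) :* b :+ c) :+ (con (+ 8) :* b :+ con (+ 3) :* c)) refl (B n) (C n) ,
    solve 2 (λ b c → con (+ 6) :* (con (+ 8) :* b :+ con (+ 3) :* c) :- c :=
      con (+ 8) :* (con (+ 3) :* b :+ c) :+ con (+ 3) :* (con (+ 8) :* b :+ con (+ 3) :* c)) refl (B n) (C n)

  B-suc : ∀ n → B (suc n) ≡ + 3 * B n + C n
  B-suc n = proj₁ (BC-suc n)

  C-suc : ∀ n → C (suc n) ≡ + 8 * B n + + 3 * C n
  C-suc n = proj₂ (BC-suc n)

  -- λ = 3 + √8 has norm 9 - 8 = 1, hence so do its powers.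
  pell : ∀ n → C n * C n ≡ 1ℤ + + 8 * (B n * B n)
  pell zero    = refl
  pell (suc n) rewrite B-suc n | C-suc n = begin
    (+ 8 * B n + + 3 * C n) * (+ 8 * B n + + 3 * C n)
      -- Exactly one copy of `C n * C n` is split off for the induction hypothesis; the rest is a
      -- multiple of 8.
      ≡⟨ solve 2 (λ b c → (con (+ 8) :* b :+ con (+ 3) :* c) :* (con (+ 8) :* b :+ con (+ 3) :* c) :=
           c :* c :+ con (+ 8) :* (con (+ 8) :* (b :* b) :+ con (+ 6) :* (b :* c) :+ c :* c)) refl (B n) (C n) ⟩
    C n * C n + + 8 * (+ 8 * (B n * B n) + + 6 * (B n * C n) + C n * C n)
      ≡⟨ cong (_+ + 8 * (+ 8 * (B n * B n) + + 6 * (B n * C n) + C n * C n)) (pell n) ⟩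
    1ℤ + + 8 * (B n * B n) + + 8 * (+ 8 * (B n * B n) + + 6 * (B n * C n) + C n * C n)
      ≡⟨ solve 2 (λ b c →
           con 1ℤ :+ con (+ 8) :* (b :* b) :+ con (+ 8) :* (con (+ 8) :* (b :* b) :+ con (+ 6) :* (b :* c) :+ c :* c) :=
           con 1ℤ :+ con (+ 8) :* ((con (+ 3) :* b :+ c) :* (con (+ 3) :* b :+ c))) refl (B n) (C n) ⟩
    1ℤ + + 8 * ((+ 3 * B n + C n) * (+ 3 * B n + C n)) ∎

  -- Together with `C-+` these are the coordinates of the product of λᵐ and λⁿ, which is why the
  -- inductions are mutual.
  B-+ : ∀ m n → B (m ℕ.+ n) ≡ B m * C n + C m * B n
  C-+ : ∀ m n → C (m ℕ.+ n) ≡ C m * C n + + 8 * (B m * B n)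
  B-+ zero    n = solve 2 (λ b c → b := con 0ℤ :* c :+ con 1ℤ :* b) refl (B n) (C n)
  B-+ (suc m) n rewrite B-suc (m ℕ.+ n) | B-+ m n | C-+ m n | B-suc m | C-suc m =
    solve 4 (λ bm cm bn cn →
      con (+ 3) :* (bm :* cn :+ cm :* bn) :+ (cm :* cn :+ con (+ 8) :* (bm :* bn)) :=
      (con (+ 3) :* bm :+ cm) :* cn :+ (con (+ 8) :* bm :+ con (+ 3) :* cm) :* bn)
      refl (B m) (C m) (B n) (C n)
  C-+ zero    n = solve 2 (λ b c → c := con 1ℤ :* c :+ con (+ 8) :* (con 0ℤ :* b)) refl (B n) (C n)
  C-+ (suc m) n rewrite C-suc (m ℕ.+ n) | B-+ m n | C-+ m n | B-suc m | C-suc m =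
    solve 4 (λ bm cm bn cn →
      con (+ 8) :* (bm :* cn :+ cm :* bn) :+ con (+ 3) :* (cm :* cn :+ con (+ 8) :* (bm :* bn)) :=
      (con (+ 8) :* bm :+ con (+ 3) :* cm) :* cn :+ con (+ 8) :* ((con (+ 3) :* bm :+ cm) :* bn))
      refl (B m) (C m) (B n) (C n)

  private
    -- Reduces an identity that holds modulo Pell's equation to a polynomial identity; z is the cofactor.
    via-pell : ∀ n {x y} z → x ≡ y + z * (C n * C n - (1ℤ + + 8 * (B n * B n))) → x ≡ y
    via-pell n {x} {y} z x≡ = trans x≡ (trans
      (cong (λ w → y + z * (w - (1ℤ + + 8 * (B n * B n)))) (pell n))
      (solve 3 (λ y z w → y :+ z :* (w :- w) := y) refl y z (1ℤ + + 8 * (B n * B n))))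

  -- λᵏ has trace 2 C_k and norm 1, so it is a root of x² - 2 C_k x + 1; the same holds for `C-rec`.
  B-rec : ∀ k n → B (k ℕ.+ (k ℕ.+ n)) ≡ + 2 * C k * B (k ℕ.+ n) - B n
  B-rec k n rewrite B-+ k (k ℕ.+ n) | B-+ k n | C-+ k n = via-pell k (- B n)
    (solve 4 (λ bk ck b c →
      bk :* (ck :* c :+ con (+ 8) :* (bk :* b)) :+ ck :* (bk :* c :+ ck :* b) :=
      con (+ 2) :* ck :* (bk :* c :+ ck :* b) :- b
        :+ (:- b) :* (ck :* ck :- (con 1ℤ :+ con (+ 8) :* (bk :* bk)))) refl (B k) (C k) (B n) (C n))

  C-rec : ∀ k n → C (k ℕ.+ (k ℕ.+ n)) ≡ + 2 * C k * C (k ℕ.+ n) - C n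
  C-rec k n rewrite C-+ k (k ℕ.+ n) | B-+ k n | C-+ k n = via-pell k (- C n)
    (solve 4 (λ bk ck b c →
      ck :* (ck :* c :+ con (+ 8) :* (bk :* b)) :+ con (+ 8) :* (bk :* (bk :* c :+ ck :* b)) :=
      con (+ 2) :* ck :* (ck :* c :+ con (+ 8) :* (bk :* b)) :- c
        :+ (:- c) :* (ck :* ck :- (con 1ℤ :+ con (+ 8) :* (bk :* bk)))) refl (B k) (C k) (B n) (C n))

  -- The recurrence with step k = s + r, run back to the index r - k = -s. B extends to negative
  -- indices as an odd function and C as an even one, hence +B_s here and -C_s in `C-reflect`: these
  -- are the values of q.
  B-reflect : ∀ s r → B (s ℕ.+ r ℕ.+ r) ≡ + 2 * C (s ℕ.+ r) * B r + B s
  B-reflect s r rewrite B-+ (s ℕ.+ r) r | B-+ s r | C-+ s r = via-pell r (B s)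
    (solve 4 (λ bs cs b c →
      (bs :* c :+ cs :* b) :* c :+ (cs :* c :+ con (+ 8) :* (bs :* b)) :* b :=
      con (+ 2) :* (cs :* c :+ con (+ 8) :* (bs :* b)) :* b :+ bs
        :+ bs :* (c :* c :- (con 1ℤ :+ con (+ 8) :* (b :* b)))) refl (B s) (C s) (B r) (C r))

  C-reflect : ∀ s r → C (s ℕ.+ r ℕ.+ r) ≡ + 2 * C (s ℕ.+ r) * C r + - C s
  C-reflect s r rewrite C-+ (s ℕ.+ r) r | B-+ s r | C-+ s r = via-pell r (- C s)
    (solve 4 (λ bs cs b c →
      (cs :* c :+ con (+ 8) :* (bs :* b)) :* c :+ con (+ 8) :* ((bs :* c :+ cs :* b) :* b) :=
      con (+ 2) :* (cs :* c :+ con (+ 8) :* (bs :* b)) :* c :+ (:- cs)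
        :+ (:- cs) :* (c :* c :- (con 1ℤ :+ con (+ 8) :* (b :* b)))) refl (B s) (C s) (B r) (C r))

  -- With k = s + r, B_r + B_s λᵏ = λˢ B_k. Multiplying by the conjugate equation gives the
  -- identity, since λ has norm 1.
  B-gram : ∀ s r → B (s ℕ.+ r) * B (s ℕ.+ r) ≡
    B r * B r + B s * B s + + 2 * C (s ℕ.+ r) * B r * B s
  B-gram s r rewrite B-+ s r | C-+ s r = via-pell r (B s * B s) (via-pell s (B r * B r)
    (solve 4 (λ bs cs b c →
      (bs :* c :+ cs :* b) :* (bs :* c :+ cs :* b) :=
      b :* b :+ bs :* bs :+ con (+ 2) :* (cs :* c :+ con (+ 8) :* (bs :* b)) :* b :* bs
        :+ bs :* bs :* (c :* c :- (con 1ℤ :+ con (+ 8) :* (b :* b)))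
        :+ b :* b :* (cs :* cs :- (con 1ℤ :+ con (+ 8) :* (bs :* bs)))) refl (B s) (C s) (B r) (C r)))

  -- With k = s + r, C_r - C_s λᵏ = -λˢ √8 B_k. The norm -8 of √8 accounts for the negative sign.
  C-gram : ∀ s r → - (+ 8 * (B (s ℕ.+ r) * B (s ℕ.+ r))) ≡
    C r * C r + - C s * - C s + + 2 * C (s ℕ.+ r) * C r * - C s
  C-gram s r rewrite B-+ s r | C-+ s r =
    via-pell r (C s * C s) (via-pell s (C r * C r)
    (solve 4 (λ bs cs b c →
      :- (con (+ 8) :* ((bs :* c :+ cs :* b) :* (bs :* c :+ cs :* b))) :=
      c :* c :+ (:- cs) :* (:- cs) :+ con (+ 2) :* (cs :* c :+ con (+ 8) :* (bs :* b)) :* c :* (:- cs)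
        :+ cs :* cs :* (c :* c :- (con 1ℤ :+ con (+ 8) :* (b :* b)))
        :+ c :* c :* (cs :* cs :- (con 1ℤ :+ con (+ 8) :* (bs :* bs)))) refl (B s) (C s) (B r) (C r)))

  -- Natural-number witnesses reduce the order arguments below to ℕ. Positivity of C drives both the
  -- strict growth of B and the nonvanishing of 8 B_k² + C_r².
  BC-nonneg : ∀ n → ∃₂ λ b c → B n ≡ + b × C n ≡ + suc c
  BC-nonneg zero    = 0 , 0 , refl , refl
  BC-nonneg (suc n) with BC-nonneg n
  ... | b , c , B≡ , C≡ =
    3 ℕ.* b ℕ.+ suc c , 8 ℕ.* b ℕ.+ (c ℕ.+ 2 ℕ.* suc c) ,
    trans (B-suc n) (cong₂ (λ x y → + 3 * x + y) B≡ C≡ ⟨ trans ⟩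
      cong (_+ + suc c) (sym (ℤₚ.pos-* 3 b))) ,
    trans (C-suc n) (cong₂ (λ x y → + 8 * x + + 3 * y) B≡ C≡ ⟨ trans ⟩
      cong₂ _+_ (sym (ℤₚ.pos-* 8 b)) (sym (ℤₚ.pos-* 3 (suc c))) ⟨ trans ⟩
      cong +_ (ℕₚ.+-suc (8 ℕ.* b) (c ℕ.+ 2 ℕ.* suc c)))

  B-<-suc : ∀ n → B n ℤ.< B (suc n)
  B-<-suc n with BC-nonneg n
  ... | b , c , B≡ , C≡ rewrite B-suc n | B≡ | C≡ | sym (ℤₚ.pos-* 3 b) =
    ℤ.+<+ (ℕₚ.≤-<-trans (ℕₚ.m≤m+n b (2 ℕ.* b)) (ℕₚ.m<m+n (3 ℕ.* b) ℕ.z<s))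

  B-mono-< : ∀ {m n} → m < n → B m ℤ.< B n
  B-mono-< {m} {suc n} m<1+n with ℕₚ.m<1+n⇒m<n∨m≡n m<1+n
  ... | inj₁ m<n  = ℤₚ.<-trans (B-mono-< m<n) (B-<-suc n)
  ... | inj₂ refl = B-<-suc n

  B-difference≢0 : ∀ {r k} → r < k → B k - B r ≢ 0ℤ
  B-difference≢0 {r} {k} r<k eq =
    ℤₚ.<⇒≢ (B-mono-< r<k) (sym (ℤₚ.i-j≡0⇒i≡j (B k) (B r) eq))

  -- Both summands are naturals, so a zero sum would make `B k` zero, while `B r` lies strictly
  -- below it.
  B-sum≢0 : ∀ {r k} → r < k → B k + B r ≢ 0ℤ
  B-sum≢0 {r} {k} r<k eq with BC-nonneg r | BC-nonneg k | B-mono-< r<k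
  ... | b , _ , B≡ , _ | b′ , _ , B≡′ , _ | lt rewrite B≡ | B≡′ with lt
  ... | ℤ.+<+ b<b′ = ℕₚ.n≮0 (subst (b <_) (ℕₚ.m+n≡0⇒m≡0 b′ (ℤₚ.+-injective eq)) b<b′)

  -- The product of the conjugate denominators 2√2 B_k ± C_r i, so inverting this one integer
  -- inverts both.
  8B²+C²≢0 : ∀ k r → + 8 * (B k * B k) + C r * C r ≢ 0ℤ
  8B²+C²≢0 k r with BC-nonneg k | BC-nonneg r
  ... | b , _ , B≡ , _ | _ , c , _ , C≡
    rewrite B≡ | C≡ | sym (ℤₚ.pos-* b b) | sym (ℤₚ.pos-* 8 (b ℕ.* b)) =
    λ eq → ℕₚ.m+1+n≢0 (8 ℕ.* (b ℕ.* b)) (ℤₚ.+-injective eq)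

-- The number rings ℚ, ℚ(√2), ℚ(√2, i) and their total inverses.

mkIsCommutativeRing : ∀ {A : Set} {_+_ _*_ : Op₂ A} { -_ : Op₁ A} {0# 1# : A} →
  (∀ x y z → (x + y) + z ≡ x + (y + z)) → (∀ x y → x + y ≡ y + x) →
  (∀ x → 0# + x ≡ x) → (∀ x → (- x) + x ≡ 0#) →
  (∀ x y z → (x * y) * z ≡ x * (y * z)) → (∀ x y → x * y ≡ y * x) →
  (∀ x → 1# * x ≡ x) → (∀ x y z → (y + z) * x ≡ (y * x) + (z * x)) →
  IsCommutativeRing _≡_ _+_ _*_ -_ 0# 1#
mkIsCommutativeRing {_+_ = _+_} {_*_} { -_} +-assoc +-comm +-idˡ -invˡ *-assoc *-comm *-idˡ distribʳ = record
  { isRing = record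
    { +-isAbelianGroup = record
      { isGroup = record
        { isMonoid = record
          { isSemigroup = record
            { isMagma = record { isEquivalence = ≡.isEquivalence ; ∙-cong = cong₂ _+_ }
            ; assoc = +-assoc
            }
          ; identity = comm∧idˡ⇒id +-comm +-idˡ
          }
        ; inverse = comm∧invˡ⇒inv +-comm -invˡ
        ; ⁻¹-cong = cong -_
        }
      ; comm = +-comm
      }
    ; *-cong = cong₂ _*_
    ; *-assoc = *-assoc
    ; *-identity = comm∧idˡ⇒id *-comm *-idˡ
    ; distrib = comm∧distrʳ⇒distrˡ {_∙_ = _*_} {_+_} *-comm distribʳ , distribʳ
    }
  ; *-comm = *-comm
  }
  where open Algebra.Consequences.Propositional

-- `x / 1` does not reduce for a variable `x`, so the comparison is made among unnormalised
-- rationals.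
⟦⟧-+ : ∀ x y → ⟦ x ℤ.+ y ⟧ ≡ ⟦ x ⟧ ℚ.+ ⟦ y ⟧
⟦⟧-+ x y = ℚₚ.toℚᵘ-injective (begin
  toℚᵘ ⟦ x ℤ.+ y ⟧               ≈⟨ ℚₚ.toℚᵘ-fromℚᵘ (mkℚᵘ (x ℤ.+ y) 0) ⟩
  mkℚᵘ (x ℤ.+ y) 0               ≈⟨ *≡* (cong (ℤ._* 1ℤ) (cong₂ ℤ._+_ (sym (ℤₚ.*-identityʳ x)) (sym (ℤₚ.*-identityʳ y)))) ⟩
  mkℚᵘ x 0 ℚᵘ.+ mkℚᵘ y 0         ≈⟨ ℚᵘₚ.+-cong (ℚₚ.toℚᵘ-fromℚᵘ (mkℚᵘ x 0)) (ℚₚ.toℚᵘ-fromℚᵘ (mkℚᵘ y 0)) ⟨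
  toℚᵘ ⟦ x ⟧ ℚᵘ.+ toℚᵘ ⟦ y ⟧     ≈⟨ ℚₚ.toℚᵘ-homo-+ ⟦ x ⟧ ⟦ y ⟧ ⟨
  toℚᵘ (⟦ x ⟧ ℚ.+ ⟦ y ⟧)         ∎)
  where open Relation.Binary.Reasoning.Setoid ℚᵘₚ.≃-setoid

⟦⟧-* : ∀ x y → ⟦ x ℤ.* y ⟧ ≡ ⟦ x ⟧ ℚ.* ⟦ y ⟧
⟦⟧-* x y = ℚₚ.toℚᵘ-injective (begin
  toℚᵘ ⟦ x ℤ.* y ⟧               ≈⟨ ℚₚ.toℚᵘ-fromℚᵘ (mkℚᵘ (x ℤ.* y) 0) ⟩
  mkℚᵘ x 0 ℚᵘ.* mkℚᵘ y 0         ≈⟨ ℚᵘₚ.*-cong (ℚₚ.toℚᵘ-fromℚᵘ (mkℚᵘ x 0)) (ℚₚ.toℚᵘ-fromℚᵘ (mkℚᵘ y 0)) ⟨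
  toℚᵘ ⟦ x ⟧ ℚᵘ.* toℚᵘ ⟦ y ⟧     ≈⟨ ℚₚ.toℚᵘ-homo-* ⟦ x ⟧ ⟦ y ⟧ ⟨
  toℚᵘ (⟦ x ⟧ ℚ.* ⟦ y ⟧)         ∎)
  where open Relation.Binary.Reasoning.Setoid ℚᵘₚ.≃-setoid

⟦⟧-neg : ∀ x → ⟦ ℤ.- x ⟧ ≡ ℚ.- ⟦ x ⟧
⟦⟧-neg x = ℚₚ.toℚᵘ-injective (begin
  toℚᵘ ⟦ ℤ.- x ⟧                 ≈⟨ ℚₚ.toℚᵘ-fromℚᵘ (mkℚᵘ (ℤ.- x) 0) ⟩
  ℚᵘ.- mkℚᵘ x 0                  ≈⟨ ℚᵘₚ.-‿cong (ℚₚ.toℚᵘ-fromℚᵘ (mkℚᵘ x 0)) ⟨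
  ℚᵘ.- toℚᵘ ⟦ x ⟧                ≈⟨ ℚₚ.toℚᵘ-homo‿- ⟦ x ⟧ ⟨
  toℚᵘ (ℚ.- ⟦ x ⟧)               ∎)
  where open Relation.Binary.Reasoning.Setoid ℚᵘₚ.≃-setoid

⟦⟧≢0 : ∀ {x} → x ≢ 0ℤ → ⟦ x ⟧ ≢ 0ℚ
⟦⟧≢0 {x} x≢0 eq with ℚₚ.fromℚᵘ-injective {mkℚᵘ x 0} {mkℚᵘ 0ℤ 0} eq
... | *≡* x*1≡0 = x≢0 (trans (sym (ℤₚ.*-identityʳ x)) x*1≡0)

invℚ-inverse : ∀ {p} → p ≢ 0ℚ → p ℚ.* invℚ p ≡ 1ℚ
invℚ-inverse {p} p≢0 with p ℚₚ.≟ 0ℚ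
... | yes p≡0 = contradiction p≡0 p≢0
... | no  p≢0 = ℚₚ.*-inverseʳ p ⦃ ℚ.≢-nonZero p≢0 ⦄

inverse-unique : ∀ {c ℓ} (R : CommutativeRing c ℓ) → let open CommutativeRing R in
  ∀ {x y z} → x * y ≈ 1# → x * z ≈ 1# → y ≈ z
inverse-unique R {x} {y} {z} xy≈1 xz≈1 =
  R.trans (R.sym (R.*-identityʳ y)) (R.trans (R.*-congˡ (R.sym xz≈1)) (R.trans (R.sym (R.*-assoc y x z))
    (R.trans (R.*-congʳ (R.trans (R.*-comm y x) xy≈1)) (R.*-identityˡ z))))
  where module R = CommutativeRing R

invℚ-unique : ∀ p q → p ℚ.* q ≡ 1ℚ → invℚ p ≡ q
invℚ-unique p q pq≡1 = inverse-unique ℚₚ.+-*-commutativeRing {p} (invℚ-inverse p≢0) pq≡1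
  where
  p≢0 : p ≢ 0ℚ
  p≢0 refl with trans (sym (ℚₚ.*-zeroˡ q)) pq≡1
  ... | ()

ℚ-ℤ⟶ : ℚₚ.+-*-commutativeRing -ℤ⟶
ℚ-ℤ⟶ = record { ⟦_⟧ = ⟦_⟧ ; +-homo = ⟦⟧-+ ; *-homo = ⟦⟧-* ; -‿homo = ⟦⟧-neg ; 0-homo = refl ; 1-homo = refl }

module ℚ-Solver = ℤ-Solver ℚₚ.+-*-commutativeRing ℚ-ℤ⟶

Q2-isCommutativeRing : IsCommutativeRing _≡_ _+₂_ _*₂_ -₂_ 0Q2 1Q2
Q2-isCommutativeRing = mkIsCommutativeRing
  (λ (a + b √2) (c + d √2) (e + f √2) → cong₂ _+_√2 (ℚₚ.+-assoc a c e) (ℚₚ.+-assoc b d f))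
  (λ (a + b √2) (c + d √2) → cong₂ _+_√2 (ℚₚ.+-comm a c) (ℚₚ.+-comm b d))
  (λ (a + b √2) → cong₂ _+_√2 (ℚₚ.+-identityˡ a) (ℚₚ.+-identityˡ b))
  (λ (a + b √2) → cong₂ _+_√2 (ℚₚ.+-inverseˡ a) (ℚₚ.+-inverseˡ b))
  (λ (a + b √2) (c + d √2) (e + f √2) → cong₂ _+_√2
    (solve 6 (λ a b c d e f →
      (a :* c :+ con (+ 2) :* (b :* d)) :* e :+ con (+ 2) :* ((a :* d :+ b :* c) :* f) :=
      a :* (c :* e :+ con (+ 2) :* (d :* f)) :+ con (+ 2) :* (b :* (c :* f :+ d :* e))) refl a b c d e f)
    (solve 6 (λ a b c d e f →
      (a :* c :+ con (+ 2) :* (b :* d)) :* f :+ (a :* d :+ b :* c) :* e :=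
      a :* (c :* f :+ d :* e) :+ b :* (c :* e :+ con (+ 2) :* (d :* f))) refl a b c d e f))
  (λ (a + b √2) (c + d √2) → cong₂ _+_√2
    (solve 4 (λ a b c d → a :* c :+ con (+ 2) :* (b :* d) := c :* a :+ con (+ 2) :* (d :* b)) refl a b c d)
    (solve 4 (λ a b c d → a :* d :+ b :* c := c :* b :+ d :* a) refl a b c d))
  (λ (a + b √2) → cong₂ _+_√2
    (solve 2 (λ a b → con 1ℤ :* a :+ con (+ 2) :* (con 0ℤ :* b) := a) refl a b)
    (solve 2 (λ a b → con 1ℤ :* b :+ con 0ℤ :* a := b) refl a b))
  (λ (e + f √2) (a + b √2) (c + d √2) → cong₂ _+_√2
    (solve 6 (λ a b c d e f → (a :+ c) :* e :+ con (+ 2) :* ((b :+ d) :* f) :=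
      (a :* e :+ con (+ 2) :* (b :* f)) :+ (c :* e :+ con (+ 2) :* (d :* f))) refl a b c d e f)
    (solve 6 (λ a b c d e f → (a :+ c) :* f :+ (b :+ d) :* e :=
      (a :* f :+ b :* e) :+ (c :* f :+ d :* e)) refl a b c d e f))
  where open ℚ-Solver

Q2-ring : CommutativeRing 0ℓ 0ℓ
Q2-ring = record { isCommutativeRing = Q2-isCommutativeRing }

ℚ→Q2 : ℚ → Q2
ℚ→Q2 p = p + 0ℚ √2

ℚ→Q2-* : ∀ p q → ℚ→Q2 (p ℚ.* q) ≡ ℚ→Q2 p *₂ ℚ→Q2 q
ℚ→Q2-* p q = cong₂ _+_√2
  (solve 2 (λ p q → p :* q := p :* q :+ con (+ 2) :* (con 0ℤ :* con 0ℤ)) refl p q)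
  (solve 2 (λ p q → con 0ℤ := p :* con 0ℤ :+ con 0ℤ :* q) refl p q)
  where open ℚ-Solver

Q2-ℤ⟶ : Q2-ring -ℤ⟶
Q2-ℤ⟶ = record
  { ⟦_⟧    = λ z → ℚ→Q2 ⟦ z ⟧
  ; +-homo = λ x y → cong ℚ→Q2 (⟦⟧-+ x y)
  ; *-homo = λ x y → trans (cong ℚ→Q2 (⟦⟧-* x y)) (ℚ→Q2-* ⟦ x ⟧ ⟦ y ⟧)
  ; -‿homo = λ x → cong ℚ→Q2 (⟦⟧-neg x)
  ; 0-homo = refl
  ; 1-homo = refl
  }

module Q2-Solver = ℤ-Solver Q2-ring Q2-ℤ⟶

K-isCommutativeRing : IsCommutativeRing _≡_ _+K_ _*K_ -K_ 0K 1K
K-isCommutativeRing = mkIsCommutativeRing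
  (λ (a + b i) (c + d i) (e + f i) → cong₂ _+_i (Q.+-assoc a c e) (Q.+-assoc b d f))
  (λ (a + b i) (c + d i) → cong₂ _+_i (Q.+-comm a c) (Q.+-comm b d))
  (λ (a + b i) → cong₂ _+_i (Q.+-identityˡ a) (Q.+-identityˡ b))
  (λ (a + b i) → cong₂ _+_i (Q.-‿inverseˡ a) (Q.-‿inverseˡ b))
  (λ (a + b i) (c + d i) (e + f i) → cong₂ _+_i
    (solve 6 (λ a b c d e f →
      (a :* c :- b :* d) :* e :- (a :* d :+ b :* c) :* f :=
      a :* (c :* e :- d :* f) :- b :* (c :* f :+ d :* e)) refl a b c d e f)
    (solve 6 (λ a b c d e f →
      (a :* c :- b :* d) :* f :+ (a :* d :+ b :* c) :* e :=
      a :* (c :* f :+ d :* e) :+ b :* (c :* e :- d :* f)) refl a b c d e f))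
  (λ (a + b i) (c + d i) → cong₂ _+_i
    (solve 4 (λ a b c d → a :* c :- b :* d := c :* a :- d :* b) refl a b c d)
    (solve 4 (λ a b c d → a :* d :+ b :* c := c :* b :+ d :* a) refl a b c d))
  (λ (a + b i) → cong₂ _+_i
    (solve 2 (λ a b → con 1ℤ :* a :- con 0ℤ :* b := a) refl a b)
    (solve 2 (λ a b → con 1ℤ :* b :+ con 0ℤ :* a := b) refl a b))
  (λ (e + f i) (a + b i) (c + d i) → cong₂ _+_i
    (solve 6 (λ a b c d e f → (a :+ c) :* e :- (b :+ d) :* f :=
      (a :* e :- b :* f) :+ (c :* e :- d :* f)) refl a b c d e f)
    (solve 6 (λ a b c d e f → (a :+ c) :* f :+ (b :+ d) :* e :=
      (a :* f :+ b :* e) :+ (c :* f :+ d :* e)) refl a b c d e f))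
  where
  open Q2-Solver
  module Q = CommutativeRing Q2-ring

K-ring : CommutativeRing 0ℓ 0ℓ
K-ring = record { isCommutativeRing = K-isCommutativeRing }

ℚ→K-* : ∀ p q → ℚ→K (p ℚ.* q) ≡ ℚ→K p *K ℚ→K q
ℚ→K-* p q = cong₂ _+_i
  (trans (ℚ→Q2-* p q)
    (solve 2 (λ p q → p :* q := p :* q :- con 0ℤ :* con 0ℤ) refl (ℚ→Q2 p) (ℚ→Q2 q)))
  (solve 2 (λ p q → con 0ℤ := p :* con 0ℤ :+ con 0ℤ :* q) refl (ℚ→Q2 p) (ℚ→Q2 q))
  where open Q2-Solver

ℤ→K-+ : ∀ x y → ℤ→K (x ℤ.+ y) ≡ ℤ→K x +K ℤ→K y
ℤ→K-+ x y = cong ℚ→K (⟦⟧-+ x y)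

ℤ→K-* : ∀ x y → ℤ→K (x ℤ.* y) ≡ ℤ→K x *K ℤ→K y
ℤ→K-* x y = trans (cong ℚ→K (⟦⟧-* x y)) (ℚ→K-* ⟦ x ⟧ ⟦ y ⟧)

ℤ→K-neg : ∀ x → ℤ→K (ℤ.- x) ≡ -K ℤ→K x
ℤ→K-neg x = cong ℚ→K (⟦⟧-neg x)

norm₂ : Q2 → ℚ
norm₂ (p + q √2) = p ℚ.* p ℚ.- (+ 2 / 1) ℚ.* (q ℚ.* q)

norm₂-* : ∀ x y → norm₂ (x *₂ y) ≡ norm₂ x ℚ.* norm₂ y
norm₂-* (a + b √2) (c + d √2) =
  solve 4 (λ a b c d →
    (a :* c :+ con (+ 2) :* (b :* d)) :* (a :* c :+ con (+ 2) :* (b :* d))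
      :- con (+ 2) :* ((a :* d :+ b :* c) :* (a :* d :+ b :* c)) :=
    (a :* a :- con (+ 2) :* (b :* b)) :* (c :* c :- con (+ 2) :* (d :* d))) refl a b c d
  where open ℚ-Solver

-- The given inverse certifies that the norm of `x` is a unit, because the norm is multiplicative.
-- Hence `invℚ` avoids its default value and the conjugate formula is a true inverse. `invK-unique`
-- repeats this one level up, with the norm from `K` to `Q2`.
inv₂-unique : ∀ x y → x *₂ y ≡ 1Q2 → inv₂ x ≡ y
inv₂-unique x@(p + q √2) y xy≡1 = inverse-unique Q2-ring {x} x*inv₂x≡1 xy≡1
  where
  open ℚ-Solver
  norms : norm₂ x ℚ.* norm₂ y ≡ 1ℚ
  norms = trans (sym (norm₂-* x y)) (cong norm₂ xy≡1)
  norm-inverse : norm₂ x ℚ.* invℚ (norm₂ x) ≡ 1ℚ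
  norm-inverse = trans (cong (norm₂ x ℚ.*_) (invℚ-unique (norm₂ x) (norm₂ y) norms)) norms
  x*inv₂x≡1 : x *₂ inv₂ x ≡ 1Q2
  x*inv₂x≡1 = cong₂ _+_√2
    (trans (solve 3 (λ p q n → p :* (p :* n) :+ con (+ 2) :* (q :* (:- (q :* n))) :=
        (p :* p :- con (+ 2) :* (q :* q)) :* n) refl p q (invℚ (norm₂ x)))
      norm-inverse)
    (solve 3 (λ p q n → p :* (:- (q :* n)) :+ q :* (p :* n) := con 0ℤ) refl p q (invℚ (norm₂ x)))

normK : K → Q2
normK (u + v i) = (u *₂ u) +₂ (v *₂ v)

normK-* : ∀ x y → normK (x *K y) ≡ normK x *₂ normK y
normK-* (a + b i) (c + d i) =
  solve 4 (λ a b c d →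
    (a :* c :- b :* d) :* (a :* c :- b :* d) :+ (a :* d :+ b :* c) :* (a :* d :+ b :* c) :=
    (a :* a :+ b :* b) :* (c :* c :+ d :* d)) refl a b c d
  where open Q2-Solver

invK-unique : ∀ x y → x *K y ≡ 1K → invK x ≡ y
invK-unique x@(u + v i) y xy≡1 = inverse-unique K-ring {x} x*invKx≡1 xy≡1
  where
  open Q2-Solver
  norms : normK x *₂ normK y ≡ 1Q2
  norms = trans (sym (normK-* x y)) (cong normK xy≡1)
  norm-inverse : normK x *₂ inv₂ (normK x) ≡ 1Q2
  norm-inverse = trans (cong (normK x *₂_) (inv₂-unique (normK x) (normK y) norms)) norms
  x*invKx≡1 : x *K invK x ≡ 1K
  x*invKx≡1 = cong₂ _+_i
    (trans (solve 3 (λ u v n → u :* (u :* n) :- v :* (:- (v :* n)) := (u :* u :+ v :* v) :* n)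
        refl u v (inv₂ (normK x)))
      norm-inverse)
    (solve 3 (λ u v n → u :* (:- (v :* n)) :+ v :* (u :* n) := con 0ℤ) refl u v (inv₂ (normK x)))

-- The inverse is found in ℚ, where being nonzero suffices, and then carried up to `K`.
ℤ→K-invK : ∀ z → z ≢ 0ℤ → ℤ→K z *K invK (ℤ→K z) ≡ 1K
ℤ→K-invK z z≢0 = trans (cong (ℤ→K z *K_) (invK-unique (ℤ→K z) y zy≡1)) zy≡1
  where
  y : K
  y = ℚ→K (invℚ ⟦ z ⟧)
  zy≡1 : ℤ→K z *K y ≡ 1K
  zy≡1 = trans (sym (ℚ→K-* ⟦ z ⟧ (invℚ ⟦ z ⟧))) (cong ℚ→K (invℚ-inverse (⟦⟧≢0 z≢0)))

open Balancing

-- Powers of inverses, and the progressions of indices k n + r.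

module Powers {c ℓ} (R : CommutativeRing c ℓ) where
  open CommutativeRing R
  open Algebra.Properties.CommutativeSemiring.Exp commutativeSemiring public
    using (_^_; ^-distrib-*; ^-congˡ)

  ^-inverse : ∀ {x y} n → x * y ≈ 1# → x ^ n * y ^ n ≈ 1#
  ^-inverse {x} {y} n xy≈1 =
    R.trans (R.sym (^-distrib-* x y n)) (R.trans (^-congˡ n xy≈1) (1^n≈1 n))
    where
    module R = CommutativeRing R
    1^n≈1 : ∀ n → 1# ^ n ≈ 1#
    1^n≈1 zero    = R.refl
    1^n≈1 (suc n) = R.trans (*-identityˡ _) (1^n≈1 n)

  -^≈[-1]^*^ : ∀ x n → (- x) ^ n ≈ (- 1#) ^ n * x ^ n
  -^≈[-1]^*^ x n = R.trans (^-congˡ n (R.sym (-1*x≈-x x))) (^-distrib-* (- 1#) x n)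
    where
    module R = CommutativeRing R
    open Algebra.Properties.Ring ring using (-1*x≈-x)

module ℚ-Powers = Powers ℚₚ.+-*-commutativeRing

k[2+n]+r : ∀ k n r → k ℕ.* suc (suc n) ℕ.+ r ≡ k ℕ.+ (k ℕ.+ (k ℕ.* n ℕ.+ r))
k[2+n]+r = solve 3 (λ k n r → k :* (con 2 :+ n) :+ r := k :+ (k :+ (k :* n :+ r))) refl
  where open Data.Nat.Solver.+-*-Solver

k[1+n]+r : ∀ k n r → k ℕ.* suc n ℕ.+ r ≡ k ℕ.+ (k ℕ.* n ℕ.+ r)
k[1+n]+r = solve 3 (λ k n r → k :* (con 1 :+ n) :+ r := k :+ (k :* n :+ r)) refl
  where open Data.Nat.Solver.+-*-Solver

module _ (k r : ℕ) (r<k : r < k) where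

  B-progression-rec : ∀ n → B (k ℕ.* suc (suc n) ℕ.+ r) ≡
    + 2 ℤ.* C k ℤ.* B (k ℕ.* suc n ℕ.+ r) ℤ.- B (k ℕ.* n ℕ.+ r)
  B-progression-rec n rewrite k[2+n]+r k n r | k[1+n]+r k n r = B-rec k (k ℕ.* n ℕ.+ r)

  C-progression-rec : ∀ n → C (k ℕ.* suc (suc n) ℕ.+ r) ≡
    + 2 ℤ.* C k ℤ.* C (k ℕ.* suc n ℕ.+ r) ℤ.- C (k ℕ.* n ℕ.+ r)
  C-progression-rec n rewrite k[2+n]+r k n r | k[1+n]+r k n r = C-rec k (k ℕ.* n ℕ.+ r)

  [k-r]+r≡k : k ∸ r ℕ.+ r ≡ k
  [k-r]+r≡k = ℕₚ.m∸n+n≡m (ℕₚ.<⇒≤ r<k)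

  B-progression-1 : B (k ℕ.* 1 ℕ.+ r) ≡ + 2 ℤ.* C k ℤ.* B r ℤ.+ B (k ∸ r)
  B-progression-1 rewrite ℕₚ.*-identityʳ k =
    subst (λ l → B (l ℕ.+ r) ≡ + 2 ℤ.* C l ℤ.* B r ℤ.+ B (k ∸ r)) [k-r]+r≡k (B-reflect (k ∸ r) r)

  C-progression-1 : C (k ℕ.* 1 ℕ.+ r) ≡ + 2 ℤ.* C k ℤ.* C r ℤ.+ ℤ.- C (k ∸ r)
  C-progression-1 rewrite ℕₚ.*-identityʳ k =
    subst (λ l → C (l ℕ.+ r) ≡ + 2 ℤ.* C l ℤ.* C r ℤ.+ ℤ.- C (k ∸ r)) [k-r]+r≡k (C-reflect (k ∸ r) r)

  B-progression-gram : B k ℤ.* B k ≡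
    B r ℤ.* B r ℤ.+ B (k ∸ r) ℤ.* B (k ∸ r) ℤ.+ + 2 ℤ.* C k ℤ.* B r ℤ.* B (k ∸ r)
  B-progression-gram =
    subst (λ l → B l ℤ.* B l ≡ B r ℤ.* B r ℤ.+ B (k ∸ r) ℤ.* B (k ∸ r) ℤ.+ + 2 ℤ.* C l ℤ.* B r ℤ.* B (k ∸ r))
      [k-r]+r≡k (B-gram (k ∸ r) r)

  C-progression-gram : ℤ.- (+ 8 ℤ.* (B k ℤ.* B k)) ≡
    C r ℤ.* C r ℤ.+ ℤ.- C (k ∸ r) ℤ.* ℤ.- C (k ∸ r) ℤ.+ + 2 ℤ.* C k ℤ.* C r ℤ.* ℤ.- C (k ∸ r)
  C-progression-gram =
    subst (λ l → ℤ.- (+ 8 ℤ.* (B l ℤ.* B l)) ≡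
        C r ℤ.* C r ℤ.+ ℤ.- C (k ∸ r) ℤ.* ℤ.- C (k ∸ r) ℤ.+ + 2 ℤ.* C l ℤ.* C r ℤ.* ℤ.- C (k ∸ r))
      [k-r]+r≡k (C-gram (k ∸ r) r)

-- The balancing identity over ℚ.

powℚ≡^ : ∀ x n → powℚ x n ≡ x ℚ-Powers.^ n
powℚ≡^ x zero    = refl
powℚ≡^ x (suc n) = cong (x ℚ.*_) (powℚ≡^ x n)

module ℚ-Convolution = Convolution ℚₚ.+-*-commutativeRing ℚ-ℤ⟶

sumℚ≡∑ : ∀ n f → sumℚ n f ≡ ℚ-Convolution.∑ n f
sumℚ≡∑ zero    f = refl
sumℚ≡∑ (suc n) f = cong (ℚ._+ f (suc n)) (sumℚ≡∑ n f)

invℚ-powℚ : ∀ x y → x ℚ.* y ≡ 1ℚ → ∀ n → invℚ (powℚ x n) ≡ y ℚ-Powers.^ n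
invℚ-powℚ x y xy≡1 n = invℚ-unique (powℚ x n) (y ℚ-Powers.^ n)
  (trans (cong (ℚ._* y ^ n) (powℚ≡^ x n)) (^-inverse n xy≡1))
  where open ℚ-Powers

module BalancingSum (k r : ℕ) (r<k : r < k) where
  b = ⟦ B k ⟧
  p = ⟦ B r ⟧
  q = ⟦ B (k ∸ r) ⟧
  h = ℚ.1/ (+ 2 / 1)
  u = invℚ (b ℚ.+ p)
  v = invℚ (b ℚ.- p)
  a : ℕ → ℤ
  a m = B (k ℕ.* m ℕ.+ r)

  [b+p]u≡1 : (b ℚ.+ p) ℚ.* u ≡ 1ℚ
  [b+p]u≡1 = invℚ-inverse (subst (_≢ 0ℚ) (⟦⟧-+ (B k) (B r)) (⟦⟧≢0 (B-sum≢0 r<k)))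

  [b-p]v≡1 : (b ℚ.- p) ℚ.* v ≡ 1ℚ
  [b-p]v≡1 = invℚ-inverse (subst (_≢ 0ℚ) (trans (⟦⟧-+ (B k) (ℤ.- B r)) (cong (b ℚ.+_) (⟦⟧-neg (B r))))
    (⟦⟧≢0 (B-difference≢0 r<k)))

  open ℚ-Convolution.IntegralSelfConvolution {a} {+ 2 ℤ.* C k} {B r} {B (k ∸ r)} {b} {h}
    (cong (λ l → B (l ℕ.+ r)) (ℕₚ.*-zeroʳ k)) (B-progression-1 k r r<k) (B-progression-rec k r r<k)
    -- The closing `refl` is 1/2 + 1/2 = 1, evaluated in ℚ.
    (trans (sym (⟦⟧-* (B k) (B k))) (cong ⟦_⟧ (B-progression-gram k r r<k))) refl
    [b+p]u≡1 [b-p]v≡1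

  open ℚ-Powers

  term : ℕ → ℕ → ℚ
  term n j = ((b ℚ.* powℚ q j) ℚ.* h)
            ℚ.* (sgnℚ j ℚ.* invℚ (powℚ (b ℚ.+ p) (suc j)) ℚ.+ invℚ (powℚ (b ℚ.- p) (suc j)))
            ℚ.* ⟦ + (suc n ∸ j) ⟧ ℚ.* ⟦ a (suc n ∸ j) ⟧

  -- Three changes of form: `j ≤ n` moves the successor out of `∸`, inverses of powers become powers
  -- of inverses, and the sign is absorbed into the power of -q.
  term≡ : ∀ n j → j ℕ.≤ n → term n j ≡
    b ℚ.* h ℚ.* ((ℚ.- q) ^ j ℚ.* u ^ suc j ℚ.+ q ^ j ℚ.* v ^ suc j)
      ℚ.* (⟦ + suc (n ∸ j) ⟧ ℚ.* ⟦ a (suc (n ∸ j)) ⟧)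
  term≡ n j j≤n = begin
    term n j
      ≡⟨ cong₂ ℚ._*_ (cong₂ ℚ._*_ (cong₂ ℚ._*_
           (cong (λ x → b ℚ.* x ℚ.* h) (powℚ≡^ q j))
           (cong₂ ℚ._+_ (cong₂ ℚ._*_ (powℚ≡^ (ℚ.- 1ℚ) j) (invℚ-powℚ (b ℚ.+ p) u [b+p]u≡1 (suc j)))
                        (invℚ-powℚ (b ℚ.- p) v [b-p]v≡1 (suc j))))
           (cong (λ l → ⟦ + l ⟧) (ℕₚ.+-∸-assoc 1 j≤n)))
           (cong (λ l → ⟦ a l ⟧) (ℕₚ.+-∸-assoc 1 j≤n)) ⟩
    b ℚ.* q ^ j ℚ.* h ℚ.* ((ℚ.- 1ℚ) ^ j ℚ.* u ^ suc j ℚ.+ v ^ suc j) ℚ.* m ℚ.* x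
      ≡⟨ solve 8 (λ b q h s u v m x →
           b :* q :* h :* (s :* u :+ v) :* m :* x :=
           b :* h :* (s :* q :* u :+ q :* v) :* (m :* x)) refl
           b (q ^ j) h ((ℚ.- 1ℚ) ^ j) (u ^ suc j) (v ^ suc j) m x ⟩
    b ℚ.* h ℚ.* ((ℚ.- 1ℚ) ^ j ℚ.* q ^ j ℚ.* u ^ suc j ℚ.+ q ^ j ℚ.* v ^ suc j) ℚ.* (m ℚ.* x)
      ≡⟨ cong (λ y → b ℚ.* h ℚ.* (y ℚ.* u ^ suc j ℚ.+ q ^ j ℚ.* v ^ suc j) ℚ.* (m ℚ.* x)) (-^≈[-1]^*^ q j) ⟨
    b ℚ.* h ℚ.* ((ℚ.- q) ^ j ℚ.* u ^ suc j ℚ.+ q ^ j ℚ.* v ^ suc j) ℚ.* (m ℚ.* x) ∎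
    where
    open ℚ-Solver
    open ≡-Reasoning
    m = ⟦ + suc (n ∸ j) ⟧
    x = ⟦ a (suc (n ∸ j)) ⟧

  identity : ∀ n → sumℚ n (λ m → ⟦ a m ℤ.* a (n ∸ m) ⟧) ≡
    q ℚ.* (ℚ.- (⟦ + suc n ⟧ ℚ.* ⟦ a (suc n) ⟧) ℚ.+ sumℚ n (term n))
  identity n = trans (sumℚ≡∑ n _) (trans (∑-integral n) (cong (λ x → q ℚ.* (ℚ.- (⟦ + suc n ⟧ ℚ.* ⟦ a (suc n) ⟧) ℚ.+ x))
    (sym (trans (sumℚ≡∑ n (term n)) (ℚ-Convolution.∑-cong n (term≡ n))))))

-- The Lucas-balancing identity over a ring with square roots of 2 and -1.

module LucasBalancingSum {c ℓ} (R : CommutativeRing c ℓ) (φ : R -ℤ⟶) where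
  private module R = CommutativeRing R
  open R using
    ( Carrier; _≈_; _+_; _*_; -_; _-_; 1#
    ; +-cong; +-congˡ; +-congʳ; *-cong; *-congˡ; *-congʳ; -‿cong; *-identityˡ)
  open _-Raw-AlmostCommutative⟶_ φ using (+-homo; *-homo; -‿homo; 1-homo) renaming (⟦_⟧ to ι)
  open ℤ-Solver R φ
  open Powers R
  open Convolution R φ using (∑; ∑-cong; ι-cong; module IntegralSelfConvolution)
  open Relation.Binary.Reasoning.Setoid R.setoid

  module Sum (k r : ℕ) (r<k : r < k) (√2 i h d : Carrier)
    (√2² : √2 * √2 ≈ ι (+ 2)) (i² : i * i ≈ ι -1ℤ) (2h≈1 : h + h ≈ 1#)
    (Md≈1 : ι (+ 8 ℤ.* (B k ℤ.* B k) ℤ.+ C r ℤ.* C r) * d ≈ 1#) where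

    -- `w⁺` and `w⁻` are the displayed denominators. Their product is the image of an integer with
    -- inverse `d`, so each is inverted by its conjugate times `d`.
    β p q w⁺ w⁻ U V : Carrier
    β  = ι (+ 2) * √2 * ι (B k)
    p  = ι (C r)
    q  = ι (C (k ∸ r))
    w⁺ = β + p * i
    w⁻ = β - p * i
    U  = w⁻ * d
    V  = w⁺ * d

    private
      M 8B² : ℤ
      8B² = + 8 ℤ.* (B k ℤ.* B k)
      M = 8B² ℤ.+ C r ℤ.* C r
      -- b + p = − i w⁺ and b − p = − i w⁻, hence the inverses u and v.
      b u v : Carrier
      b = - (i * β)
      u = i * U
      v = i * V
      a : ℕ → ℤ
      a m = C (k ℕ.* m ℕ.+ r)

    β²≈8B² : β * β ≈ ι 8B²
    β²≈8B² = begin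
      β * β
        ≈⟨ solve 2 (λ s x → con (+ 2) :* s :* x :* (con (+ 2) :* s :* x) := con (+ 4) :* (s :* s) :* (x :* x))
             R.refl √2 (ι (B k)) ⟩
      ι (+ 4) * (√2 * √2) * (ι (B k) * ι (B k))
        ≈⟨ *-congʳ (R.trans (*-congˡ √2²) (R.sym (*-homo (+ 4) (+ 2)))) ⟩
      ι (+ 8) * (ι (B k) * ι (B k))
        ≈⟨ R.trans (*-homo (+ 8) (B k ℤ.* B k)) (*-congˡ (*-homo (B k) (B k))) ⟨
      ι 8B² ∎

    w⁺w⁻≈M : w⁺ * w⁻ ≈ ι M
    w⁺w⁻≈M = begin
      w⁺ * w⁻
        ≈⟨ solve 3 (λ y p i → (y :+ p :* i) :* (y :- p :* i) := y :* y :- (i :* i) :* (p :* p)) R.refl β p i ⟩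
      β * β - i * i * (p * p)
        ≈⟨ +-cong β²≈8B² (-‿cong (*-congʳ i²)) ⟩
      ι 8B² - ι -1ℤ * (p * p)
        ≈⟨ solve 2 (λ y z → y :- con -1ℤ :* z := y :+ z) R.refl (ι 8B²) (p * p) ⟩
      ι 8B² + p * p
        ≈⟨ R.trans (+-homo 8B² (C r ℤ.* C r)) (+-congˡ (*-homo (C r) (C r))) ⟨
      ι M ∎

    w⁺U≈1 : w⁺ * U ≈ 1#
    w⁺U≈1 = R.trans (R.sym (R.*-assoc w⁺ w⁻ d)) (R.trans (*-congʳ w⁺w⁻≈M) Md≈1)

    w⁻V≈1 : w⁻ * V ≈ 1#
    w⁻V≈1 = R.trans (R.sym (R.*-assoc w⁻ w⁺ d))
      (R.trans (*-congʳ (R.trans (R.*-comm w⁻ w⁺) w⁺w⁻≈M)) Md≈1)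

    private
      -i²≈1 : - (i * i) ≈ 1#
      -i²≈1 = R.trans (-‿cong i²) (R.trans (R.sym (-‿homo -1ℤ)) 1-homo)

      [b+p]u≈1 : (b + p) * u ≈ 1#
      [b+p]u≈1 = begin
        (b + p) * u
          ≈⟨ solve 4 (λ y p i U → (:- (i :* y) :+ p) :* (i :* U) := (:- (i :* i) :* y :+ p :* i) :* U)
               R.refl β p i U ⟩
        (- (i * i) * β + p * i) * U
          ≈⟨ *-congʳ (+-congʳ (R.trans (*-congʳ -i²≈1) (*-identityˡ β))) ⟩
        w⁺ * U  ≈⟨ w⁺U≈1 ⟩
        1#      ∎

      [b-p]v≈1 : (b - p) * v ≈ 1#
      [b-p]v≈1 = begin
        (b - p) * v
          ≈⟨ solve 4 (λ y p i V → (:- (i :* y) :- p) :* (i :* V) := (:- (i :* i) :* y :- p :* i) :* V)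
               R.refl β p i V ⟩
        (- (i * i) * β - p * i) * V
          ≈⟨ *-congʳ (+-congʳ (R.trans (*-congʳ -i²≈1) (*-identityˡ β))) ⟩
        w⁻ * V  ≈⟨ w⁻V≈1 ⟩
        1#      ∎

      b²≈-8B² : b * b ≈ ι (ℤ.- 8B²)
      b²≈-8B² = begin
        b * b
          ≈⟨ solve 2 (λ y i → :- (i :* y) :* :- (i :* y) := (i :* i) :* (y :* y)) R.refl β i ⟩
        i * i * (β * β)   ≈⟨ *-cong i² β²≈8B² ⟩
        ι -1ℤ * ι 8B²     ≈⟨ solve 1 (λ y → con -1ℤ :* y := :- y) R.refl (ι 8B²) ⟩
        - ι 8B²           ≈⟨ -‿homo 8B² ⟨
        ι (ℤ.- 8B²)       ∎

    F′ : ℕ → Carrier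
    F′ n = ι (+ suc n) * ι (a (suc n))

    private
      G : ℕ → Carrier
      G j = β * (q * i) ^ j * h * (U ^ suc j + (- 1#) ^ j * V ^ suc j)

      expansion : Carrier → ℕ → Carrier
      expansion x j = b * h * ((- x) ^ j * u ^ suc j + x ^ j * v ^ suc j)

      expansion-cong : ∀ {x y} j → x ≈ y → expansion x j ≈ expansion y j
      expansion-cong j x≈y = *-congˡ (+-cong (*-congʳ (^-congˡ j (-‿cong x≈y))) (*-congʳ (^-congˡ j x≈y)))

      -- Of the j + 1 factors i in uʲ⁺¹ and vʲ⁺¹, one cancels the -i of `b` and the others turn qʲ
      -- into (q i)ʲ. As the linear coefficient is -q, the alternating sign lands on the `V` term,
      -- opposite to the balancing case.
      expansion≈G : ∀ j → expansion (- q) j ≈ G j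
      expansion≈G j = begin
        b * h * ((- (- q)) ^ j * u ^ suc j + (- q) ^ j * v ^ suc j)
          ≈⟨ *-congˡ (+-cong
               (*-cong (^-congˡ j (solve 1 (λ q → :- (:- q) := q) R.refl q)) (^-distrib-* i U (suc j)))
               (*-cong (-^≈[-1]^*^ q j) (^-distrib-* i V (suc j)))) ⟩
        b * h * (q ^ j * (i * i ^ j * U ^ suc j) + s * q ^ j * (i * i ^ j * V ^ suc j))
          ≈⟨ solve 8 (λ i y h q I U V s →
               :- (i :* y) :* h :* (q :* (i :* I :* U) :+ s :* q :* (i :* I :* V)) :=
               :- (i :* i) :* (y :* (q :* I) :* h :* (U :+ s :* V)))
               R.refl i β h (q ^ j) (i ^ j) (U ^ suc j) (V ^ suc j) s ⟩
        - (i * i) * (β * (q ^ j * i ^ j) * h * (U ^ suc j + s * V ^ suc j))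
          ≈⟨ R.trans (*-congʳ -i²≈1) (*-identityˡ _) ⟩
        β * (q ^ j * i ^ j) * h * (U ^ suc j + s * V ^ suc j)
          ≈⟨ *-congʳ (*-congʳ (*-congˡ (^-distrib-* q i j))) ⟨
        G j ∎
        where s = (- 1#) ^ j

    ∑-C-convolution : ∀ n → ∑ n (λ m → ι (a m ℤ.* a (n ∸ m))) ≈
      q * (F′ n - ∑ n (λ j →
        β * (q * i) ^ j * h * (U ^ suc j + (- 1#) ^ j * V ^ suc j) * F′ (n ∸ j)))
    ∑-C-convolution n = begin
      ∑ n (λ m → ι (a m ℤ.* a (n ∸ m)))
        ≈⟨ ∑-integral n ⟩
      ι (ℤ.- C (k ∸ r)) * (- F′ n + ∑ n (λ j → expansion (ι (ℤ.- C (k ∸ r))) j * F′ (n ∸ j)))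
        ≈⟨ *-cong (-‿homo (C (k ∸ r))) (+-congˡ (∑-cong n (λ j _ → *-congʳ
             (R.trans (expansion-cong j (-‿homo (C (k ∸ r)))) (expansion≈G j))))) ⟩
      - q * (- F′ n + ∑ n (λ j → G j * F′ (n ∸ j)))
        -- The sign of the linear coefficient flips both outer signs relative to the balancing
        -- formula.
        ≈⟨ solve 3 (λ q f y → :- q :* (:- f :+ y) := q :* (f :- y)) R.refl q (F′ n) (∑ n (λ j → G j * F′ (n ∸ j))) ⟩
      q * (F′ n - ∑ n (λ j → G j * F′ (n ∸ j))) ∎
      where
      open IntegralSelfConvolution {a} {+ 2 ℤ.* C k} {C r} {ℤ.- C (k ∸ r)} {b} {h}
        (cong (λ l → C (l ℕ.+ r)) (ℕₚ.*-zeroʳ k)) (C-progression-1 k r r<k) (C-progression-rec k r r<k)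
        (R.trans b²≈-8B² (ι-cong (C-progression-gram k r r<k))) 2h≈1 [b+p]u≈1 [b-p]v≈1

-- The operations are abstract because those of K compute: comparing two products in K unfolds both
-- of them into records of large rational expressions.
module AbstractField {A : Set} {_+_ _*_ _-_ : A → A → A} { -_ : A → A} {0# 1# : A}
  (isCommutativeRing : IsCommutativeRing _≡_ _+_ _*_ -_ 0# 1#)
  (sub : ∀ x y → x - y ≡ x + (- y))
  (ι : ℤ → A)
  (+-homo : ∀ x y → ι (x ℤ.+ y) ≡ ι x + ι y)
  (*-homo : ∀ x y → ι (x ℤ.* y) ≡ ι x * ι y)
  (-‿homo : ∀ x → ι (ℤ.- x) ≡ - ι x)
  (0-homo : ι 0ℤ ≡ 0#) (1-homo : ι 1ℤ ≡ 1#)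
  (inv : A → A) (inv-unique : ∀ x y → x * y ≡ 1# → inv x ≡ y)
  (inv-ι : ∀ z → z ≢ 0ℤ → ι z * inv (ι z) ≡ 1#)
  (pow : A → ℕ → A) (pow-zero : ∀ x → pow x 0 ≡ 1#) (pow-suc : ∀ x n → pow x (suc n) ≡ x * pow x n)
  (sgn : ℕ → A) (sgn-zero : sgn 0 ≡ 1#) (sgn-suc : ∀ n → sgn (suc n) ≡ (- 1#) * sgn n)
  (sum : ℕ → (ℕ → A) → A) (sum-zero : ∀ f → sum 0 f ≡ f 0) (sum-suc : ∀ n f → sum (suc n) f ≡ sum n f + f (suc n))
  (√2 i : A) (√2² : √2 * √2 ≡ ι (+ 2)) (i² : i * i ≡ ι -1ℤ)
  where

  R : CommutativeRing 0ℓ 0ℓ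
  R = record { isCommutativeRing = isCommutativeRing }

  φ : R -ℤ⟶
  φ = record
    { ⟦_⟧ = ι ; +-homo = +-homo ; *-homo = *-homo ; -‿homo = -‿homo ; 0-homo = 0-homo ; 1-homo = 1-homo }

  open CommutativeRing R using (*-assoc; *-identityˡ; distribʳ)
  open Powers R
  open Convolution R φ using (∑; ∑-cong)

  pow≡^ : ∀ x n → pow x n ≡ x ^ n
  pow≡^ x zero    = pow-zero x
  pow≡^ x (suc n) = trans (pow-suc x n) (cong (x *_) (pow≡^ x n))

  sgn≡^ : ∀ n → sgn n ≡ (- 1#) ^ n
  sgn≡^ zero    = sgn-zero
  sgn≡^ (suc n) = trans (sgn-suc n) (cong ((- 1#) *_) (sgn≡^ n))

  sum≡∑ : ∀ n f → sum n f ≡ ∑ n f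
  sum≡∑ zero    f = sum-zero f
  sum≡∑ (suc n) f = trans (sum-suc n f) (cong (_+ f (suc n)) (sum≡∑ n f))

  inv-pow : ∀ {x y} → x * y ≡ 1# → ∀ n → inv (pow x n) ≡ y ^ n
  inv-pow {x} {y} xy≡1 n = inv-unique _ _ (trans (cong (_* (y ^ n)) (pow≡^ x n)) (^-inverse n xy≡1))

  2h≡1 : inv (ι (+ 2)) + inv (ι (+ 2)) ≡ 1#
  2h≡1 = trans (sym (trans (cong (_* h) (trans (+-homo 1ℤ 1ℤ) (cong₂ _+_ 1-homo 1-homo)))
    (trans (distribʳ h 1# 1#) (cong₂ _+_ (*-identityˡ h) (*-identityˡ h))))) (inv-ι (+ 2) (λ ()))
    where h = inv (ι (+ 2))

  module _ (k r : ℕ) (r<k : r < k) where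

    open LucasBalancingSum.Sum R φ k r r<k √2 i (inv (ι (+ 2)))
      (inv (ι (+ 8 ℤ.* (B k ℤ.* B k) ℤ.+ C r ℤ.* C r)))
      √2² i² 2h≡1 (inv-ι _ (8B²+C²≢0 k r))

    c : A
    c = ι (C (k ∸ r))

    F : ℕ → A
    F m = ι (C (k ℕ.* m ℕ.+ r))

    w⁻-sub : β - (p * i) ≡ w⁻
    w⁻-sub = sub β (p * i)

    term : ∀ n j → j ℕ.≤ n →
      ((((((((ι (+ 2) * √2) * ι (B k)) * pow (c * i) j) * inv (ι (+ 2)))
        * (inv (pow (((ι (+ 2) * √2) * ι (B k)) + (ι (C r) * i)) (suc j))
           + (sgn j * inv (pow (((ι (+ 2) * √2) * ι (B k)) - (ι (C r) * i)) (suc j)))))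
        * ι (+ (suc n ∸ j)))
        * F (suc n ∸ j))) ≡
      (((β * ((c * i) ^ j)) * inv (ι (+ 2))) * ((U ^ suc j) + (((- 1#) ^ j) * (V ^ suc j)))) * F′ (n ∸ j)
    term n j j≤n = trans
      (cong₂ _*_ (cong₂ _*_ (cong₂ _*_
        (cong (λ x → (β * x) * inv (ι (+ 2))) (pow≡^ (c * i) j))
        (cong₂ _+_ (inv-pow w⁺U≈1 (suc j))
          (cong₂ _*_ (sgn≡^ j) (trans (cong (λ w → inv (pow w (suc j))) w⁻-sub) (inv-pow w⁻V≈1 (suc j))))))
        (cong (λ l → ι (+ l)) (ℕₚ.+-∸-assoc 1 j≤n)))
        (cong F (ℕₚ.+-∸-assoc 1 j≤n)))
      (*-assoc _ _ _)

    identity : ∀ n → sum n (λ m → ι (C (k ℕ.* m ℕ.+ r) ℤ.* C (k ℕ.* (n ∸ m) ℕ.+ r))) ≡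
      ι (C (k ∸ r)) * ((ι (+ suc n) * ι (C (k ℕ.* suc n ℕ.+ r))) - sum n (λ j →
        (((((((ι (+ 2) * √2) * ι (B k)) * pow (ι (C (k ∸ r)) * i) j) * inv (ι (+ 2)))
        * (inv (pow (((ι (+ 2) * √2) * ι (B k)) + (ι (C r) * i)) (suc j))
           + (sgn j * inv (pow (((ι (+ 2) * √2) * ι (B k)) - (ι (C r) * i)) (suc j)))))
        * ι (+ (suc n ∸ j)))
        * ι (C (k ℕ.* (suc n ∸ j) ℕ.+ r)))))
    identity n = trans (sum≡∑ n _) (trans (∑-C-convolution n) (cong (c *_)
      (trans (cong (λ y → F′ n + (- y)) (sym (trans (sum≡∑ n _) (∑-cong n (term n)))))
        (sym (sub (F′ n) _)))))

-- Specialisation to ℚ(√2, i).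

√2K² : √2K *K √2K ≡ ℤ→K (+ 2)
√2K² = refl

𝕚² : 𝕚 *K 𝕚 ≡ ℤ→K -1ℤ
𝕚² = refl

x-Ky≡x+K-Ky : ∀ x y → x -K y ≡ x +K (-K y)
x-Ky≡x+K-Ky _ _ = refl

powK-suc : ∀ x n → powK x (suc n) ≡ x *K powK x n
powK-suc _ _ = refl

sgnK-suc : ∀ j → ℚ→K (sgnℚ (suc j)) ≡ (-K 1K) *K ℚ→K (sgnℚ j)
sgnK-suc j = ℚ→K-* (ℚ.- 1ℚ) (sgnℚ j)

sumK-suc : ∀ n f → sumK (suc n) f ≡ sumK n f +K f (suc n)
sumK-suc _ _ = refl

C-convolution-identity : (k r : ℕ) → r < k → (n : ℕ) →
    sumK n (λ m → ℤ→K (C (k ℕ.* m ℕ.+ r) ℤ.* C (k ℕ.* (n ∸ m) ℕ.+ r)))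
      ≡ ℤ→K (C (k ∸ r)) *K (ℤ→K (ℤ.+ (suc n)) *K ℤ→K (C (k ℕ.* suc n ℕ.+ r))
          -K sumK n (λ j →
            ((ℤ→K (ℤ.+ 2) *K √2K *K ℤ→K (B k) *K powK (ℤ→K (C (k ∸ r)) *K 𝕚) j)
              *K invK (ℤ→K (ℤ.+ 2)))
            *K (invK (powK (ℤ→K (ℤ.+ 2) *K √2K *K ℤ→K (B k) +K ℤ→K (C r) *K 𝕚) (suc j))
                +K ℚ→K (sgnℚ j)
                   *K invK (powK (ℤ→K (ℤ.+ 2) *K √2K *K ℤ→K (B k) -K ℤ→K (C r) *K 𝕚) (suc j)))
            *K ℤ→K (ℤ.+ (suc n ∸ j))
            *K ℤ→K (C (k ℕ.* (suc n ∸ j) ℕ.+ r))))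
C-convolution-identity k r r<k n = AbstractField.identity K-isCommutativeRing x-Ky≡x+K-Ky
  ℤ→K ℤ→K-+ ℤ→K-* ℤ→K-neg refl refl
  invK invK-unique ℤ→K-invK
  powK (λ _ → refl) powK-suc
  (λ j → ℚ→K (sgnℚ j)) refl sgnK-suc
  sumK (λ _ → refl) sumK-suc
  √2K 𝕚 √2K² 𝕚² k r r<k n

theorem1 : (k r : ℕ) → r < k → (n : ℕ) →
    (sumℚ n (λ m → ⟦ B (k ℕ.* m ℕ.+ r) ℤ.* B (k ℕ.* (n ∸ m) ℕ.+ r) ⟧)
    ≡ ⟦ B (k ∸ r) ⟧ ℚ.* (ℚ.- (⟦ ℤ.+ (suc n) ⟧ ℚ.* ⟦ B (k ℕ.* suc n ℕ.+ r) ⟧)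
    ℚ.+ sumℚ n (λ j →
    ((⟦ B k ⟧ ℚ.* powℚ ⟦ B (k ∸ r) ⟧ j) ℚ.* ℚ.1/ (ℤ.+ 2 / 1))
    ℚ.* (sgnℚ j ℚ.* invℚ (powℚ (⟦ B k ⟧ ℚ.+ ⟦ B r ⟧) (suc j))
    ℚ.+ invℚ (powℚ (⟦ B k ⟧ ℚ.- ⟦ B r ⟧) (suc j)))
    ℚ.* ⟦ ℤ.+ (suc n ∸ j) ⟧
    ℚ.* ⟦ B (k ℕ.* (suc n ∸ j) ℕ.+ r) ⟧)))
    ×
    (sumK n (λ m → ℤ→K (C (k ℕ.* m ℕ.+ r) ℤ.* C (k ℕ.* (n ∸ m) ℕ.+ r)))
    ≡ ℤ→K (C (k ∸ r)) *K (ℤ→K (ℤ.+ (suc n)) *K ℤ→K (C (k ℕ.* suc n ℕ.+ r))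
    -K sumK n (λ j →
    ((ℤ→K (ℤ.+ 2) *K √2K *K ℤ→K (B k) *K powK (ℤ→K (C (k ∸ r)) *K 𝕚) j)
    *K invK (ℤ→K (ℤ.+ 2)))
    *K (invK (powK (ℤ→K (ℤ.+ 2) *K √2K *K ℤ→K (B k) +K ℤ→K (C r) *K 𝕚) (suc j))
    +K ℚ→K (sgnℚ j)
    *K invK (powK (ℤ→K (ℤ.+ 2) *K √2K *K ℤ→K (B k) -K ℤ→K (C r) *K 𝕚) (suc j)))
    *K ℤ→K (ℤ.+ (suc n ∸ j))
    *K ℤ→K (C (k ℕ.* (suc n ∸ j) ℕ.+ r)))))
theorem1 k r r<k n = BalancingSum.identity k r r<k n , C-convolution-identity k r r<k n
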